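{- Consider $w\in\mathfrak{S}_n$, with the Bruhat order on $\mathfrak{S}_n$, and let $T$ be the support of $w$. Then $[\sigma,w]$ is boolean (equivalently, a modular lattice, or a distributive lattice) for all $\sigma\in T$ if and only if $w$ is a product of distinct generators (meaning that the principal order ideal of $w$ in the Bruhat order is also boolean), or $w=\sigma_{k+1}\sigma_k\sigma_{k+1}$ for some $k$.
   Context: $\mathfrak{S}_n$ is the symmetric group with Coxeter generators $\sigma_1,\dots,\sigma_{n-1}$, where $\sigma_i$ is the transposition swapping $i$ and $i+1$. A reduced decomposition of $w$ is a word of minimal length in these generators with product $w$. The support of $w$ is the set of generators appearing in reduced decompositions of $w$. Bruhat order: $v\le w$ if some reduced decomposition of $v$ is a (not necessarily contiguous) subword of a reduced decomposition of $w$. $[v,w]=\{u: v\le u\le w\}$ for $v\le w$, and the principal order ideal of $w$ is $\{u: u\le w\}$. A poset is boolean if it is isomorphic to the poset of all subsets of a finite set, ordered by inclusion. The identity counts as the empty product of distinct generators. -}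

module Defs where

open import Level using (Level; _⊔_; 0ℓ)
open import Data.Nat.Base using (ℕ; suc; _≤_)
open import Data.Fin.Base using (Fin; suc; inject₁; toℕ)
open import Data.Fin.Permutation using (Permutation′; _≈_; id; _∘ₚ_; transpose)
open import Data.Fin.Subset using (Subset) renaming (_⊆_ to _⊆ˢ_)
open import Data.List.Base using (List; []; _∷_; length)
open import Data.List.Membership.Propositional using () renaming (_∈_ to _∈ˡ_)
open import Data.List.Relation.Binary.Sublist.Propositional using (_⊆_)
open import Data.List.Relation.Unary.Unique.Propositional using (Unique)
open import Data.Product.Base using (Σ; ∃; ∃-syntax; _×_; proj₁)
open import Function.Base using (_on_)
open import Relation.Binary.Bundles.Raw using (RawRelation)
open import Relation.Binary.Core using (Rel)
open import Relation.Binary.Lattice.Structures using (IsLattice; IsDistributiveLattice)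
open import Relation.Binary.Morphism.Structures using (IsOrderIsomorphism)
open import Relation.Binary.PropositionalEquality.Core using (_≡_)
open import Relation.Unary using (Pred)

private
  variable
    n : ℕ
    c ℓ₁ ℓ₂ : Level

-- 𝔖 n is the symmetric group on n + 1 letters, so that its Coxeter generators
-- are indexed by Fin n.  Permutations are compared pointwise, by _≈_.
𝔖 : ℕ → Set
𝔖 n = Permutation′ (suc n)

infixr 9 _·_

-- Composition of functions, right factor first; _∘ₚ_ is in diagrammatic order.
_·_ : 𝔖 n → 𝔖 n → 𝔖 n
v · w = w ∘ₚ v

σ : Fin n → 𝔖 n
σ i = transpose (inject₁ i) (suc i)

Word : ℕ → Set
Word n = List (Fin n)

⟦_⟧ : Word n → 𝔖 n
⟦ [] ⟧    = id
⟦ i ∷ s ⟧ = σ i · ⟦ s ⟧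

_IsReducedDecompositionOf_ : Word n → 𝔖 n → Set
s IsReducedDecompositionOf w =
  ⟦ s ⟧ ≈ w × (∀ t → ⟦ t ⟧ ≈ w → length s ≤ length t)

support : 𝔖 n → Pred (Fin n) 0ℓ
support w i = ∃[ s ] s IsReducedDecompositionOf w × i ∈ˡ s

infix 4 _≤ᴮ_

-- _⊆_ on lists is the (not necessarily contiguous) subword relation.
_≤ᴮ_ : Rel (𝔖 n) 0ℓ
v ≤ᴮ w = ∃[ s ] ∃[ t ]
  s IsReducedDecompositionOf v × t IsReducedDecompositionOf w × s ⊆ t

IsProductOfDistinctGenerators : 𝔖 n → Set
IsProductOfDistinctGenerators w = ∃[ s ] Unique s × ⟦ s ⟧ ≈ w

-- w = σ_{k+1} σ_k σ_{k+1}, where l stands for k + 1.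
IsBraid : 𝔖 n → Set
IsBraid {n} w = Σ (Fin n) λ k → Σ (Fin n) λ l →
  toℕ l ≡ suc (toℕ k) × w ≈ σ l · σ k · σ l

-- The order induced by the Bruhat order on a set of permutations.
Induced : Pred (𝔖 n) 0ℓ → RawRelation 0ℓ 0ℓ 0ℓ
Induced P = record
  { Carrier = ∃ P
  ; _≈_     = _≈_ on proj₁
  ; _∼_     = _≤ᴮ_ on proj₁
  }

[_,_] : 𝔖 n → 𝔖 n → RawRelation 0ℓ 0ℓ 0ℓ
[ v , w ] = Induced λ u → v ≤ᴮ u × u ≤ᴮ w

↓_ : 𝔖 n → RawRelation 0ℓ 0ℓ 0ℓ
↓ w = Induced λ u → u ≤ᴮ w

-- The properties below are stated for raw relations: being a partial order
-- follows from the isomorphism in the first, and is part of IsLattice in the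
-- other two.
module _ (P : RawRelation c ℓ₁ ℓ₂) where

  private
    open module P = RawRelation P
      using (Carrier) renaming (_≈_ to _≈ᴾ_; _∼_ to _≤ᴾ_)

  IsBoolean : Set (c ⊔ ℓ₁ ⊔ ℓ₂)
  IsBoolean = Σ ℕ λ m → Σ (Carrier → Subset m)
    (IsOrderIsomorphism _≈ᴾ_ _≡_ _≤ᴾ_ _⊆ˢ_)

  FormsModularLattice : Set (c ⊔ ℓ₁ ⊔ ℓ₂)
  FormsModularLattice =
    Σ (Carrier → Carrier → Carrier) λ _∨_ →
    Σ (Carrier → Carrier → Carrier) λ _∧_ →
      IsLattice _≈ᴾ_ _≤ᴾ_ _∨_ _∧_ ×
      (∀ x y z → x ≤ᴾ z → (x ∨ (y ∧ z)) ≈ᴾ ((x ∨ y) ∧ z))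

  FormsDistributiveLattice : Set (c ⊔ ℓ₁ ⊔ ℓ₂)
  FormsDistributiveLattice =
    Σ (Carrier → Carrier → Carrier) λ _∨_ →
    Σ (Carrier → Carrier → Carrier) λ _∧_ →
      IsDistributiveLattice _≈ᴾ_ _≤ᴾ_ _∨_ _∧_

{-# OPTIONS --safe #-}

-- Left descents, the strong exchange condition and the lifting property give three facts
-- about the Bruhat order: intervals are graded, those of rank two have exactly two intermediate
-- elements, and the ideal below a product of distinct generators is boolean.
--
-- A modular lattice with the first two properties is boolean: a coatom d has a complement a,
-- and the lattice is the product of the ideal below d with {0̂ , a}.  This yields the
-- equivalence of the three lattice properties, and the passage from ↓ w to its upper intervals.
--
-- Conversely, in a boolean interval [v , w] every covering u ⋖ u′ has exactly one atom below u′
-- but not below u.  For v = 1 and u′ = σ i · u this says that i is a letter new to u.  For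
-- v = σ j, it is applied to a factor i p i of a reduced word of w, with i not in p and no
-- repeated letter in p.  Taking j in p, σ i · σ j is below i p i but not below p i; taking
-- j = i, there is only one such atom, so p is a single letter m.  Finally, a letter j next to
-- i m i would require an atom of [σ j , w] below i m i j but not m i j, or below j i m i but
-- not j i m, and there is none.
module Submission where

open import Defs
open import Data.Empty using (⊥-elim)
open import Data.Fin.Base using (Fin; zero; suc; inject₁; toℕ)
open import Data.Fin.Permutation
  using (Permutation′; _⟨$⟩ʳ_; _⟨$⟩ˡ_; inverseˡ; inverseʳ; id; transpose)
import Data.Fin.Permutation.Components as PC
open import Data.Fin.Permutation.Transposition.List
  using (TranspositionList; eval; decompose; eval-decompose)
open import Data.Fin.Properties using (toℕ-injective; toℕ-inject₁; _≟_; all?; any?)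
open import Data.Fin.Subset using (Subset; inside; outside; _∪_; _∩_; ⁅_⁆)
  renaming (_⊆_ to _⊆ˢ_; _∈_ to _∈ˢ_; _∉_ to _∉ˢ_)
open import Data.Fin.Subset.Properties
  using ( ⊆-antisym; s⊆s; out⊆; drop-∷-⊆; p∩q⊆p; p∩q⊆q; x∈p∩q⁺; p⊆p∪q; q⊆p∪q; x∈p∪q⁻
        ; ∩-distribˡ-∪; x∈⁅x⁆; x∈⁅y⁆⇒x≡y )
  renaming (⊆-reflexive to ⊆ˢ-reflexive; ⊆-trans to ⊆ˢ-trans; _∈?_ to _∈ˢ?_)
open import Data.List.Base using ([]; _∷_; _++_; length; initLast; _∷ʳ′_)
import Data.List.Membership.DecPropositional as DecMembership
open import Data.List.Membership.Propositional using () renaming (_∈_ to _∈ˡ_; _∉_ to _∉ˡ_)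
open import Data.List.Membership.Propositional.Properties using (∈-++⁺ˡ; ∈-++⁺ʳ)
open import Data.List.Properties using (length-++; ++-assoc)
open import Data.List.Relation.Binary.Equality.Propositional using (≋⇒≡)
open import Data.List.Relation.Binary.Sublist.Heterogeneous.Properties
  using (toPointwise; length-mono-≤)
open import Data.List.Relation.Binary.Sublist.Propositional
  using (_⊆_; []; _∷_; _∷ʳ_; ⊆-refl; ⊆-trans; from∈; lookup; minimum)
open import Data.List.Relation.Binary.Sublist.Propositional.Properties using (++⁺ˡ; ++⁺)
import Data.List.Relation.Unary.All.Properties as All
open import Data.List.Relation.Unary.AllPairs using ([]; _∷_)
open import Data.List.Relation.Unary.Any using (here; there)
open import Data.List.Relation.Unary.Unique.Propositional using (Unique)
open import Data.Nat.Base using (ℕ; zero; suc; _+_; _∸_; _≤_; _<_; z≤n; s≤s)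
open import Data.Nat.Properties as ℕ using (≤-refl; ≤-trans; <-irrefl; <-asym; <-cmp)
open import Data.Product.Base using (∃; ∃₂; _×_; _,_; proj₁; proj₂)
open import Data.Sum.Base using (_⊎_; inj₁; inj₂)
open import Data.Vec.Base using ([]; _∷_; here)
open import Function.Base using (_∘_; case_of_)
open import Function.Bundles using (_⇔_; mk⇔)
open import Level using (0ℓ)
open import Relation.Binary.Bundles.Raw using (RawRelation)
open import Relation.Binary.Core using (Rel)
open import Relation.Binary.Definitions using (tri<; tri≈; tri>)
open import Relation.Binary.Lattice.Structures using (IsLattice; IsDistributiveLattice)
open import Relation.Binary.Morphism.Structures using (IsOrderIsomorphism)
open import Relation.Binary.PropositionalEquality
  using (_≡_; _≢_; refl; sym; trans; cong; cong₂; subst; subst₂; module ≡-Reasoning)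
open import Relation.Binary.Structures using (IsPartialOrder)
open import Relation.Nullary using (¬_; Dec; yes; no; contradiction)
open import Relation.Nullary.Decidable
  using (_×-dec_; _⊎-dec_; map′; does; dec-true; dec-false; ¬?; decidable-stable)
open import Relation.Unary using (Pred; _∈_)

-- Modularity and gradedness alone do not give a boolean lattice: a chain of three elements and the
-- lattice with three atoms between bottom and top are both modular. Each is an interval of rank
-- two, and having exactly two intermediate elements there excludes both at once. The order is
-- defined by the existence of two suitable reduced words, a form that supports neither transitivity
-- nor induction. Both become available once the elements below `w` are known to be the products of
-- subwords of any freely chosen reduced word of `w`; the commutation and braid relations are used
-- to prove this independence. A covering in a boolean lattice adds exactly one element to the
-- corresponding subset. The new atom is the singleton of that element, which gives its existence
-- and its uniqueness.

private
  variable
    n : ℕ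

-- Modular lattices

-- Kept apart from the lattice argument because the same notions are applied to the whole Bruhat
-- order, which is not assumed to be a lattice, and to its intervals.
module Ranked {A : Set} (_≈_ _≤_ : Rel A 0ℓ) (rank : A → ℕ) where

  record Between (x y z : A) : Set where
    constructor between
    field
      lower    : x ≤ z
      upper    : z ≤ y
      rank-suc : rank z ≡ suc (rank x)

  record Diamond (x y : A) : Set where
    field
      left right    : A
      left-between  : Between x y left
      right-between : Between x y right
      distinct      : ¬ left ≈ right
      exhaustive    : ∀ z → Between x y z → z ≈ left ⊎ z ≈ right

-- The values of φ outside the principal ideal below c are irrelevant.
record BooleanIdeal {A : Set} (_≤_ : Rel A 0ℓ) (c : A) (m : ℕ) : Set where
  field
    φ        : A → Subset m
    mono     : ∀ {x y} → x ≤ c → y ≤ c → x ≤ y → φ x ⊆ˢ φ y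
    cancel   : ∀ {x y} → x ≤ c → y ≤ c → φ x ⊆ˢ φ y → x ≤ y
    preimage : ∀ S → ∃ λ x → x ≤ c × φ x ≡ S

module ModularLattice {A : Set} {_≈_ _⊑_ : Rel A 0ℓ} {_∨_ _∧_ : A → A → A}
  (isLattice : IsLattice _≈_ _⊑_ _∨_ _∧_)
  (modular   : ∀ x y z → x ⊑ z → (x ∨ (y ∧ z)) ≈ ((x ∨ y) ∧ z))
  (0̂         : A) (0̂≤ : ∀ x → 0̂ ⊑ x)
  (_⊑?_      : ∀ x y → Dec (x ⊑ y))
  (rank      : A → ℕ)
  (rank-mono : ∀ {x y} → x ⊑ y → rank x ≤ rank y)
  (rank-≈    : ∀ {x y} → x ⊑ y → rank y ≤ rank x → x ≈ y)
  (coatom    : ∀ {x y} → x ⊑ y → rank x < rank y → ∃ λ d → x ⊑ d × d ⊑ y × rank y ≡ suc (rank d))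
  (diamond   : ∀ {x y} → x ⊑ y → rank y ≡ 2 + rank x → Ranked.Diamond _≈_ _⊑_ rank x y)
  where

  open IsLattice isLattice
    using (x≤x∨y; y≤x∨y; ∨-least; x∧y≤x; x∧y≤y; ∧-greatest; reflexive; antisym; module Eq)
    renaming (refl to ⊑-refl; trans to ⊑-trans)
  open Ranked _≈_ _⊑_ rank

  infixr 5 _⨾_
  _⨾_ : ∀ {x y z} → x ⊑ y → y ⊑ z → x ⊑ z
  _⨾_ = ⊑-trans

  ≥-of : ∀ {x y} → x ≈ y → y ⊑ x
  ≥-of p = reflexive (Eq.sym p)

  rank-cong : ∀ {x y} → x ≈ y → rank x ≡ rank y
  rank-cong p = ℕ.≤-antisym (rank-mono (reflexive p)) (rank-mono (≥-of p))

  rank-≢ : ∀ {x y} → rank y ≡ suc (rank x) → ¬ y ⊑ x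
  rank-≢ {x} e y≤x = <-irrefl refl (subst (_≤ rank x) e (rank-mono y≤x))

  ≰⇒rank< : ∀ {x y} → x ⊑ y → ¬ y ⊑ x → rank x < rank y
  ≰⇒rank< x≤y y≰x = ℕ.≰⇒> λ r → y≰x (≥-of (rank-≈ x≤y r))

  squeeze : ∀ {d c v} → rank c ≡ suc (rank d) → d ⊑ v → v ⊑ c → v ⊑ d ⊎ c ⊑ v
  squeeze {d} {c} {v} e d≤v v≤c with rank v ℕ.≤? rank d
  ... | yes r = inj₁ (≥-of (rank-≈ d≤v r))
  ... | no r  = inj₂ (≥-of (rank-≈ v≤c (subst (_≤ rank v) (sym e) (ℕ.≰⇒> r))))

  -- Insert a coatom `v` of `x` above `x ∧ d`. As `d` is a coatom of `c`, the join `v ∨ d` is `d` or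
  -- `c`. In the first case `v` is `x ∧ d`; in the second the modular law gives
  -- `x ⊑ (v ∨ d) ∧ x ≈ v ∨ (d ∧ x) ⊑ v`, which is absurd.
  meet-cover : ∀ {c d x} → d ⊑ c → rank c ≡ suc (rank d) → x ⊑ c → ¬ x ⊑ d →
    rank x ≡ suc (rank (x ∧ d))
  meet-cover {c} {d} {x} d≤c e x≤c x≰d =
    case coatom (x∧y≤x x d) (≰⇒rank< (x∧y≤x x d) (λ p → x≰d (p ⨾ x∧y≤y x d))) of λ where
      (v , y≤v , v≤x , ev) →
        case squeeze e (y≤x∨y v d) (∨-least (v≤x ⨾ x≤c) d≤c) of λ where
          (inj₁ vd≤d) → trans ev (cong suc
            (rank-cong (antisym (∧-greatest v≤x (x≤x∨y v d ⨾ vd≤d)) y≤v)))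
          (inj₂ c≤vd) → contradiction
            (∧-greatest (x≤c ⨾ c≤vd) ⊑-refl
              ⨾ ≥-of (modular v d x v≤x)
              ⨾ ∨-least ⊑-refl (∧-greatest (x∧y≤y d x) (x∧y≤x d x) ⨾ y≤v))
            (rank-≢ ev)

  -- Dual to `meet-cover`, but again through a coatom: for `v` a coatom of `x ∨ z` above `x`, the
  -- meet `z ∧ v` is `y` or `z`, and the modular law turns the first case into `v ≈ x`.
  join-cover : ∀ {x y z} → y ⊑ x → y ⊑ z → rank z ≡ suc (rank y) → ¬ z ⊑ x →
    rank (x ∨ z) ≡ suc (rank x)
  join-cover {x} {y} {z} y≤x y≤z e z≰x =
    case coatom (x≤x∨y x z) (≰⇒rank< (x≤x∨y x z) (λ p → z≰x (y≤x∨y x z ⨾ p))) of λ where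
      (v , x≤v , v≤xz , ev) →
        case squeeze e (∧-greatest y≤z (y≤x ⨾ x≤v)) (x∧y≤x z v) of λ where
          (inj₁ zv≤y) → trans ev (cong suc (rank-cong (antisym
            (∧-greatest v≤xz ⊑-refl ⨾ ≥-of (modular x z v x≤v) ⨾ ∨-least ⊑-refl (zv≤y ⨾ y≤x))
            x≤v)))
          (inj₂ z≤zv) → contradiction (∨-least x≤v (z≤zv ⨾ x∧y≤y z v)) (rank-≢ ev)

  -- Otherwise x, z and (x ∨ z) ∧ d would be three elements strictly inside the
  -- interval [x ∧ d , x ∨ z] of rank two.
  meet-injective : ∀ {c d x z} → d ⊑ c → rank c ≡ suc (rank d) → x ⊑ c → z ⊑ c →
    ¬ x ⊑ d → ¬ z ⊑ d → (x ∧ d) ≈ (z ∧ d) → x ≈ z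
  meet-injective {c} {d} {x} {z} d≤c e x≤c z≤c x≰d z≰d eq = go (z ⊑? x)
    where
    rank-x : rank x ≡ suc (rank (x ∧ d))
    rank-x = meet-cover d≤c e x≤c x≰d

    rank-z : rank z ≡ suc (rank (x ∧ d))
    rank-z = trans (meet-cover d≤c e z≤c z≰d) (cong suc (sym (rank-cong eq)))

    y≤z : (x ∧ d) ⊑ z
    y≤z = reflexive eq ⨾ x∧y≤x z d

    go : Dec (z ⊑ x) → x ≈ z
    go (yes z≤x) = Eq.sym (rank-≈ z≤x (ℕ.≤-reflexive (trans rank-x (sym rank-z))))
    go (no z≰x)  = pigeonhole (exhaustive x (between (x∧y≤x x d) (x≤x∨y x z) rank-x))
                              (exhaustive z (between y≤z (y≤x∨y x z) rank-z))
                              (exhaustive t∧d t∧d-between)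
      where
      t t∧d : A
      t   = x ∨ z
      t∧d = t ∧ d

      rank-t : rank t ≡ 2 + rank (x ∧ d)
      rank-t = trans (join-cover (x∧y≤x x d) y≤z rank-z z≰x) (cong suc rank-x)

      open Diamond (diamond (x∧y≤x x d ⨾ x≤x∨y x z) rank-t)

      t∧d-between : Between (x ∧ d) t t∧d
      t∧d-between = between (∧-greatest (x∧y≤x x d ⨾ x≤x∨y x z) (x∧y≤y x d)) (x∧y≤x t d)
        (ℕ.suc-injective (trans (sym (meet-cover d≤c e (∨-least x≤c z≤c) (λ p → x≰d (x≤x∨y x z ⨾ p)))) rank-t))

      absurd-x : ∀ {p} → x ≈ p → t∧d ≈ p → x ≈ z
      absurd-x q r = contradiction (reflexive (Eq.trans q (Eq.sym r)) ⨾ x∧y≤y t d) x≰d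

      absurd-z : ∀ {p} → z ≈ p → t∧d ≈ p → x ≈ z
      absurd-z q r = contradiction (reflexive (Eq.trans q (Eq.sym r)) ⨾ x∧y≤y t d) z≰d

      pigeonhole : ∀ {p q} → x ≈ p ⊎ x ≈ q → z ≈ p ⊎ z ≈ q → t∧d ≈ p ⊎ t∧d ≈ q → x ≈ z
      pigeonhole (inj₁ a) (inj₁ b) _        = Eq.trans a (Eq.sym b)
      pigeonhole (inj₂ a) (inj₂ b) _        = Eq.trans a (Eq.sym b)
      pigeonhole (inj₁ a) (inj₂ b) (inj₁ c) = absurd-x a c
      pigeonhole (inj₁ a) (inj₂ b) (inj₂ c) = absurd-z b c
      pigeonhole (inj₂ a) (inj₁ b) (inj₁ c) = absurd-z b c
      pigeonhole (inj₂ a) (inj₁ b) (inj₂ c) = absurd-x a c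

  -- Meant for `d` a coatom of `c`, where `¬ a ⊑ d` amounts to the join of `a` and `d` being `c`.
  Complement : A → A → Set
  Complement c d = ∃ λ a → a ⊑ c × ¬ a ⊑ d × (a ∧ d) ⊑ 0̂

  -- Induction on the rank of `d`, bounded by `k`. For a coatom `b` of `d`, let `c′` be the element
  -- other than `d` strictly inside the rank-two interval from `b` to `c`. Then `b` is a coatom of
  -- `c′`, and since `c′ ∧ d ⊑ b`, a complement of `b` below `c′` is also one of `d` below `c`.
  complement-≤ : ∀ k {c d} → rank d ≤ k → d ⊑ c → rank c ≡ suc (rank d) → Complement c d
  complement-≤ k {c} {d} d≤k d≤c e with rank d ℕ.≤? rank 0̂
  -- Here `d` is the bottom, so `c` is an atom and complements `d` itself.
  ... | yes r = c , ⊑-refl , rank-≢ e , (x∧y≤y c d ⨾ ≥-of (rank-≈ (0̂≤ d) r))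
  complement-≤ zero d≤k d≤c e | no r = contradiction (≤-trans d≤k z≤n) r
  complement-≤ (suc k) {c} {d} d≤k d≤c e | no r = case coatom (0̂≤ d) (ℕ.≰⇒> r) of λ where
      (b , _ , b≤d , eb) → side b≤d eb (diamond (b≤d ⨾ d≤c) (trans e (cong suc eb)))
    where
    module _ {b : A} (b≤d : b ⊑ d) (eb : rank d ≡ suc (rank b)) where

      via : ∀ {c′} → Between b c c′ → ¬ d ≈ c′ → Complement c d
      via {c′} (between b≤c′ c′≤c e′) d≉c′ =
        case complement-≤ k (ℕ.≤-pred (subst (_≤ suc k) eb d≤k)) b≤c′ e′ of λ where
          (a , a≤c′ , a≰b , ab≤0̂) → a , (a≤c′ ⨾ c′≤c) ,
            (λ a≤d → a≰b (∧-greatest a≤c′ a≤d ⨾ c′d≤b)) ,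
            (∧-greatest (x∧y≤x a d) (∧-greatest (x∧y≤x a d ⨾ a≤c′) (x∧y≤y a d) ⨾ c′d≤b) ⨾ ab≤0̂)
        where
        c′d≤b : (c′ ∧ d) ⊑ b
        c′d≤b with squeeze eb (∧-greatest b≤c′ b≤d) (x∧y≤y c′ d)
        ... | inj₁ p = p
        ... | inj₂ p = contradiction
          (rank-≈ (p ⨾ x∧y≤x c′ d) (ℕ.≤-reflexive (trans e′ (sym eb)))) d≉c′

      side : Diamond b c → Complement c d
      side D = case exhaustive d (between b≤d d≤c eb) of λ where
          (inj₁ d≈l) → via right-between (λ d≈r → distinct (Eq.trans (Eq.sym d≈l) d≈r))
          (inj₂ d≈r) → via left-between (λ d≈l → distinct (Eq.trans (Eq.sym d≈l) d≈r))
        where open Diamond D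

  -- With d a coatom below c and a a complement of d, the ideal below c is the product of the
  -- ideal below d with {0̂ , a}.
  booleanIdeal : ∀ m {c} → rank c ≡ m + rank 0̂ → BooleanIdeal _⊑_ c m
  booleanIdeal zero {c} e = record
    { φ        = λ _ → []
    ; mono     = λ _ _ _ → λ ()
    ; cancel   = λ x≤c _ _ → x≤c ⨾ ≥-of (rank-≈ (0̂≤ c) (ℕ.≤-reflexive e)) ⨾ 0̂≤ _
    ; preimage = λ { [] → c , ⊑-refl , refl }
    }
  booleanIdeal (suc m) {c} e =
    case coatom (0̂≤ c) (subst (rank 0̂ <_) (sym e) (s≤s (ℕ.m≤n+m (rank 0̂) m))) of λ where
      (d , _ , d≤c , ed) → extend d≤c ed (complement-≤ (rank d) ≤-refl d≤c ed)
                             (booleanIdeal m (ℕ.suc-injective (trans (sym ed) e)))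
    where
    extend : ∀ {d} → d ⊑ c → rank c ≡ suc (rank d) → Complement c d → BooleanIdeal _⊑_ d m →
      BooleanIdeal _⊑_ c (suc m)
    extend {d} d≤c ed (a , a≤c , a≰d , ad≤0̂) ideal = record
      { φ        = λ x → φᵈ (a ⊑? x)
      ; mono     = λ {x} {y} _ _ → monoᵈ (a ⊑? x) (a ⊑? y)
      ; cancel   = λ {x} {y} x≤c _ → cancelᵈ (a ⊑? x) (a ⊑? y) x≤c
      ; preimage = preimageᵈ
      }
      where
      open BooleanIdeal ideal

      φᵈ : ∀ {x} → Dec (a ⊑ x) → Subset (suc m)
      φᵈ {x} (yes _) = inside ∷ φ (x ∧ d)
      φᵈ {x} (no _)  = outside ∷ φ (x ∧ d)

      φ-∧-mono : ∀ {x y} → x ⊑ y → φ (x ∧ d) ⊆ˢ φ (y ∧ d)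
      φ-∧-mono {x} {y} x≤y =
        mono (x∧y≤y x d) (x∧y≤y y d) (∧-greatest (x∧y≤x x d ⨾ x≤y) (x∧y≤y x d))

      monoᵈ : ∀ {x y} (ax : Dec (a ⊑ x)) (ay : Dec (a ⊑ y)) → x ⊑ y → φᵈ ax ⊆ˢ φᵈ ay
      monoᵈ (yes _)  (yes _)  x≤y = s⊆s (φ-∧-mono x≤y)
      monoᵈ (yes ax) (no ¬ay) x≤y = contradiction (ax ⨾ x≤y) ¬ay
      monoᵈ (no _)   (yes _)  x≤y = out⊆ (φ-∧-mono x≤y)
      monoᵈ (no _)   (no _)   x≤y = out⊆ (φ-∧-mono x≤y)

      below-d : ∀ {x} → x ⊑ d → ((x ∨ a) ∧ d) ≈ x
      below-d {x} x≤d = antisym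
        (≥-of (modular x a d x≤d) ⨾ ∨-least ⊑-refl (ad≤0̂ ⨾ 0̂≤ x))
        (∧-greatest (x≤x∨y x a) x≤d)

      -- By `below-d`, both sides have the same meet with the coatom `d`, and `meet-injective` says
      -- that this meet determines an element outside the ideal of `d`.
      decomposition : ∀ {x} → x ⊑ c → ¬ x ⊑ d → x ≈ ((x ∧ d) ∨ a)
      decomposition {x} x≤c x≰d = meet-injective d≤c ed x≤c (∨-least (x∧y≤x x d ⨾ x≤c) a≤c)
        x≰d (λ p → a≰d (y≤x∨y (x ∧ d) a ⨾ p)) (Eq.sym (below-d (x∧y≤y x d)))

      φ-tail : ∀ {x y} (ax : Dec (a ⊑ x)) (ay : Dec (a ⊑ y)) → φᵈ ax ⊆ˢ φᵈ ay → (x ∧ d) ⊑ y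
      φ-tail {x} {y} (yes _) (yes _) s = cancel (x∧y≤y x d) (x∧y≤y y d) (drop-∷-⊆ s) ⨾ x∧y≤x y d
      φ-tail {x} {y} (yes _) (no _)  s = cancel (x∧y≤y x d) (x∧y≤y y d) (drop-∷-⊆ s) ⨾ x∧y≤x y d
      φ-tail {x} {y} (no _)  (yes _) s = cancel (x∧y≤y x d) (x∧y≤y y d) (drop-∷-⊆ s) ⨾ x∧y≤x y d
      φ-tail {x} {y} (no _)  (no _)  s = cancel (x∧y≤y x d) (x∧y≤y y d) (drop-∷-⊆ s) ⨾ x∧y≤x y d

      φ-head : ∀ {x y} (ax : Dec (a ⊑ x)) (ay : Dec (a ⊑ y)) → φᵈ ax ⊆ˢ φᵈ ay → a ⊑ x → a ⊑ y
      φ-head _        (yes ay) _ _  = ay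
      φ-head (yes _)  (no _)   s _  = case s {zero} here of λ ()
      φ-head (no ¬ax) (no _)   _ ax = contradiction ax ¬ax

      cancelᵈ : ∀ {x y} (ax : Dec (a ⊑ x)) (ay : Dec (a ⊑ y)) → x ⊑ c → φᵈ ax ⊆ˢ φᵈ ay → x ⊑ y
      cancelᵈ {x} ax ay x≤c s = case x ⊑? d of λ where
        (yes x≤d) → ∧-greatest ⊑-refl x≤d ⨾ φ-tail ax ay s
        (no x≰d)  → let x≈ = decomposition x≤c x≰d in
          reflexive x≈ ⨾ ∨-least (φ-tail ax ay s)
            (φ-head ax ay s (y≤x∨y (x ∧ d) a ⨾ ≥-of x≈))

      φ-resp : ∀ {x y} → x ⊑ d → y ≈ x → φ y ≡ φ x
      φ-resp x≤d p = ⊆-antisym (mono (reflexive p ⨾ x≤d) x≤d (reflexive p))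
                               (mono x≤d (reflexive p ⨾ x≤d) (≥-of p))

      φ-outside : ∀ {x} (ax : Dec (a ⊑ x)) → x ⊑ d → φᵈ ax ≡ outside ∷ φ x
      φ-outside (yes ax) x≤d = contradiction (ax ⨾ x≤d) a≰d
      φ-outside (no _)   x≤d = cong (outside ∷_)
        (φ-resp x≤d (antisym (x∧y≤x _ d) (∧-greatest ⊑-refl x≤d)))

      φ-inside : ∀ {x} (ax : Dec (a ⊑ (x ∨ a))) → x ⊑ d → φᵈ ax ≡ inside ∷ φ x
      φ-inside (yes _)  x≤d = cong (inside ∷_) (φ-resp x≤d (below-d x≤d))
      φ-inside (no ¬ax) x≤d = contradiction (y≤x∨y _ a) ¬ax

      preimageᵈ : ∀ S → ∃ λ x → x ⊑ c × φᵈ (a ⊑? x) ≡ S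
      preimageᵈ (outside ∷ S) = case preimage S of λ where
        (x , x≤d , eq) → x , (x≤d ⨾ d≤c) , trans (φ-outside (a ⊑? x) x≤d) (cong (outside ∷_) eq)
      preimageᵈ (inside ∷ S) = case preimage S of λ where
        (x , x≤d , eq) → (x ∨ a) , ∨-least (x≤d ⨾ d≤c) a≤c ,
          trans (φ-inside (a ⊑? (x ∨ a)) x≤d) (cong (inside ∷_) eq)

-- Left descents and reduced words

-- Unlike _≈_, whose sides cannot be recovered from the type, this wrapper lets
-- the permutations be inferred.
infix 4 _≃_
record _≃_ (v w : 𝔖 n) : Set where
  constructor pointwise
  field at : ∀ x → v ⟨$⟩ʳ x ≡ w ⟨$⟩ʳ x
open _≃_

≃-refl : {w : 𝔖 n} → w ≃ w
≃-refl = pointwise λ _ → refl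

≃-sym : {v w : 𝔖 n} → v ≃ w → w ≃ v
≃-sym p = pointwise λ x → sym (at p x)

≃-trans : {u v w : 𝔖 n} → u ≃ v → v ≃ w → u ≃ w
≃-trans p q = pointwise λ x → trans (at p x) (at q x)

≃-inverse : {v w : 𝔖 n} → v ≃ w → ∀ x → v ⟨$⟩ˡ x ≡ w ⟨$⟩ˡ x
≃-inverse {v = v} {w} p x = begin
  v ⟨$⟩ˡ x                        ≡⟨ cong (v ⟨$⟩ˡ_) (inverseʳ w) ⟨
  v ⟨$⟩ˡ (w ⟨$⟩ʳ (w ⟨$⟩ˡ x))      ≡⟨ cong (v ⟨$⟩ˡ_) (at p (w ⟨$⟩ˡ x)) ⟨
  v ⟨$⟩ˡ (v ⟨$⟩ʳ (w ⟨$⟩ˡ x))      ≡⟨ inverseˡ v ⟩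
  w ⟨$⟩ˡ x                        ∎
  where open ≡-Reasoning

·-congˡ : (v : 𝔖 n) {u w : 𝔖 n} → u ≃ w → v · u ≃ v · w
·-congˡ v p = pointwise λ x → cong (v ⟨$⟩ʳ_) (at p x)

transpose-fst : (a b : Fin n) → PC.transpose a b a ≡ b
transpose-fst a b with a ≟ a
... | yes _  = refl
... | no a≢a = contradiction refl a≢a

transpose-snd : (a b : Fin n) → PC.transpose a b b ≡ a
transpose-snd a b with b ≟ a
... | yes b≡a = b≡a
... | no _ with b ≟ b
...   | yes _  = refl
...   | no b≢b = contradiction refl b≢b

transpose-other : {a b c : Fin n} → c ≢ a → c ≢ b → PC.transpose a b c ≡ c
transpose-other {a = a} {b} {c} c≢a c≢b with c ≟ a
... | yes c≡a = contradiction c≡a c≢a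
... | no _ with c ≟ b
...   | yes c≡b = contradiction c≡b c≢b
...   | no _    = refl

transpose-conj : (π : Permutation′ n) (a b c : Fin n) →
  π ⟨$⟩ʳ PC.transpose a b c ≡ PC.transpose (π ⟨$⟩ʳ a) (π ⟨$⟩ʳ b) (π ⟨$⟩ʳ c)
transpose-conj π a b c with c ≟ a
... | yes refl = sym (transpose-fst (π ⟨$⟩ʳ a) (π ⟨$⟩ʳ b))
... | no c≢a with c ≟ b
...   | yes refl = sym (transpose-snd (π ⟨$⟩ʳ a) (π ⟨$⟩ʳ b))
...   | no c≢b   = sym (transpose-other (c≢a ∘ injective) (c≢b ∘ injective))
  where
  injective : ∀ {x y} → π ⟨$⟩ʳ x ≡ π ⟨$⟩ʳ y → x ≡ y
  injective {x} {y} e = trans (sym (inverseˡ π)) (trans (cong (π ⟨$⟩ˡ_) e) (inverseˡ π))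

transpose-comm : (a b c : Fin n) → PC.transpose a b c ≡ PC.transpose b a c
transpose-comm a b c with c ≟ b
... | yes refl = transpose-snd a b
... | no c≢b with c ≟ a
...   | yes refl = refl
...   | no c≢a with c ≟ b
...     | yes c≡b = contradiction c≡b c≢b
...     | no _    = refl

σ-involutive : (i : Fin n) {w : 𝔖 n} → σ i · (σ i · w) ≃ w
σ-involutive i {w} = pointwise λ x →
  trans (cong (PC.transpose (inject₁ i) (suc i)) (transpose-comm (inject₁ i) (suc i) (w ⟨$⟩ʳ x)))
        (PC.transpose-inverse (inject₁ i) (suc i))

σ-cancel : (i : Fin n) {v w : 𝔖 n} → σ i · v ≃ σ i · w → v ≃ w
σ-cancel i p = ≃-trans (≃-sym (σ-involutive i)) (≃-trans (·-congˡ (σ i) p) (σ-involutive i))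

σ-flip : (i : Fin n) {v w : 𝔖 n} → σ i · v ≃ w → v ≃ σ i · w
σ-flip i p = σ-cancel i (≃-trans p (≃-sym (σ-involutive i)))

inject₁≢suc : (i : Fin n) → inject₁ i ≢ suc i
inject₁≢suc i e = ℕ.m≢1+m+n (toℕ i) {0}
  (trans (trans (sym (toℕ-inject₁ i)) (cong toℕ e)) (cong suc (sym (ℕ.+-identityʳ (toℕ i)))))

-- Exchanging two consecutive values can reverse no order but their own.
σ-mono-< : (i : Fin n) {a b : Fin (suc n)} → toℕ a < toℕ b → ¬ (a ≡ inject₁ i × b ≡ suc i) →
  toℕ (σ i ⟨$⟩ˡ a) < toℕ (σ i ⟨$⟩ˡ b)
σ-mono-< i {a} {b} a<b ne with a ≟ suc i
... | yes refl = go (b ≟ suc i) (b ≟ inject₁ i)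
  where
  go : Dec (b ≡ suc i) → Dec (b ≡ inject₁ i) → toℕ (inject₁ i) < toℕ (σ i ⟨$⟩ˡ b)
  go (yes refl) _ = contradiction a<b (<-irrefl refl)
  go (no _) (yes refl) = contradiction (subst (suc (toℕ i) <_) (toℕ-inject₁ i) a<b) (ℕ.<⇒≯ ≤-refl)
  go (no p) (no q) rewrite transpose-other p q | toℕ-inject₁ i = ℕ.<⇒≤ a<b
... | no a≢si with a ≟ inject₁ i
...   | yes refl = go (b ≟ suc i) (b ≟ inject₁ i)
  where
  go : Dec (b ≡ suc i) → Dec (b ≡ inject₁ i) → suc (toℕ i) < toℕ (σ i ⟨$⟩ˡ b)
  go (yes e) _ = contradiction (refl , e) ne
  go (no _) (yes refl) = contradiction a<b (<-irrefl refl)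
  go (no p) (no q) rewrite transpose-other p q =
    ℕ.≤∧≢⇒< (subst (_< toℕ b) (toℕ-inject₁ i) a<b) (λ e → p (toℕ-injective (sym e)))
...   | no a≢i with b ≟ suc i
...     | yes refl = subst (toℕ a <_) (sym (toℕ-inject₁ i))
  (ℕ.≤∧≢⇒< (ℕ.≤-pred a<b) (λ e → a≢i (toℕ-injective (trans e (sym (toℕ-inject₁ i))))))
...     | no _ with b ≟ inject₁ i
...       | yes refl = ℕ.m<n⇒m<1+n (subst (toℕ a <_) (toℕ-inject₁ i) a<b)
...       | no _ = a<b

⟦++⟧ : (s t : Word n) → ⟦ s ++ t ⟧ ≃ ⟦ s ⟧ · ⟦ t ⟧
⟦++⟧ []      t = ≃-refl
⟦++⟧ (i ∷ s) t = ·-congˡ (σ i) (⟦++⟧ s t)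

-- The pair `a`, `b` is carried through the letters of `s`. It starts in order and ends inverted, so
-- by `σ-mono-<` some letter swaps exactly the current pair. That letter is deleted; conjugation by
-- the letters before it turns its transposition back into that of `a` and `b`.
strong-exchange : (s : Word n) {a b : Fin (suc n)} → toℕ a < toℕ b →
  toℕ (⟦ s ⟧ ⟨$⟩ˡ b) < toℕ (⟦ s ⟧ ⟨$⟩ˡ a) →
  ∃ λ s′ → s′ ⊆ s × length s ≡ suc (length s′) × ⟦ s′ ⟧ ≃ transpose a b · ⟦ s ⟧
strong-exchange [] a<b b<a = contradiction b<a (<-asym a<b)
strong-exchange {n} (i ∷ s) {a} {b} a<b inv = go ((a ≟ inject₁ i) ×-dec (b ≟ suc i))
  where
  a′ b′ : Fin (suc n)
  a′ = σ i ⟨$⟩ˡ a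
  b′ = σ i ⟨$⟩ˡ b

  go : Dec (a ≡ inject₁ i × b ≡ suc i) →
    ∃ λ s′ → s′ ⊆ i ∷ s × length (i ∷ s) ≡ suc (length s′) × ⟦ s′ ⟧ ≃ transpose a b · ⟦ i ∷ s ⟧
  go (yes (refl , refl)) = s , i ∷ʳ ⊆-refl , refl , ≃-sym (σ-involutive i)
  go (no ne) with strong-exchange s (σ-mono-< i a<b ne) inv
  ... | s′ , s′⊆s , len , eq = i ∷ s′ , refl ∷ s′⊆s , cong suc len , pointwise λ x → begin
    σ i ⟨$⟩ʳ (⟦ s′ ⟧ ⟨$⟩ʳ x)
      ≡⟨ cong (σ i ⟨$⟩ʳ_) (at eq x) ⟩
    σ i ⟨$⟩ʳ PC.transpose a′ b′ (⟦ s ⟧ ⟨$⟩ʳ x)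
      ≡⟨ transpose-conj (σ i) a′ b′ (⟦ s ⟧ ⟨$⟩ʳ x) ⟩
    PC.transpose (σ i ⟨$⟩ʳ a′) (σ i ⟨$⟩ʳ b′) (⟦ i ∷ s ⟧ ⟨$⟩ʳ x)
      ≡⟨ cong₂ (λ c d → PC.transpose c d (⟦ i ∷ s ⟧ ⟨$⟩ʳ x)) (inverseʳ (σ i)) (inverseʳ (σ i)) ⟩
    PC.transpose a b (⟦ i ∷ s ⟧ ⟨$⟩ʳ x) ∎
    where open ≡-Reasoning

-- Left multiplication by `σ i` exchanges two values of `w`, so the positions of these values are
-- compared. Being free of words, the condition is decidable and respects `_≃_`; that it means
-- shortening is `len-Descent`.
record Descent (i : Fin n) (w : 𝔖 n) : Set where
  constructor descent
  field inversion : toℕ (w ⟨$⟩ˡ suc i) < toℕ (w ⟨$⟩ˡ inject₁ i)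
open Descent

Descent? : (i : Fin n) (w : 𝔖 n) → Dec (Descent i w)
Descent? i w = map′ descent inversion (toℕ (w ⟨$⟩ˡ suc i) ℕ.<? toℕ (w ⟨$⟩ˡ inject₁ i))

Descent-resp : {i : Fin n} {v w : 𝔖 n} → v ≃ w → Descent i v → Descent i w
Descent-resp p (descent d) =
  descent (subst₂ (λ a b → toℕ a < toℕ b) (≃-inverse p _) (≃-inverse p _) d)

private
  σ-inject₁ : (i : Fin n) (w : 𝔖 n) → (σ i · w) ⟨$⟩ˡ inject₁ i ≡ w ⟨$⟩ˡ suc i
  σ-inject₁ i w = cong (w ⟨$⟩ˡ_) (transpose-snd (suc i) (inject₁ i))

  σ-suc : (i : Fin n) (w : 𝔖 n) → (σ i · w) ⟨$⟩ˡ suc i ≡ w ⟨$⟩ˡ inject₁ i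
  σ-suc i w = cong (w ⟨$⟩ˡ_) (transpose-fst (suc i) (inject₁ i))

¬Descent-σ : {i : Fin n} {w : 𝔖 n} → Descent i w → ¬ Descent i (σ i · w)
¬Descent-σ {i = i} {w} (descent d) (descent e) =
  <-asym d (subst₂ (λ a b → toℕ a < toℕ b) (σ-suc i w) (σ-inject₁ i w) e)

Descent-σ : {i : Fin n} {w : 𝔖 n} → ¬ Descent i w → Descent i (σ i · w)
Descent-σ {i = i} {w} ¬d = descent
  (subst₂ (λ a b → toℕ a < toℕ b) (sym (σ-suc i w)) (sym (σ-inject₁ i w))
    (ℕ.≤∧≢⇒< (ℕ.≮⇒≥ (¬d ∘ descent)) (λ e → inject₁≢suc i (injective (toℕ-injective e)))))
  where
  injective : ∀ {x y} → w ⟨$⟩ˡ x ≡ w ⟨$⟩ˡ y → x ≡ y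
  injective e = trans (sym (inverseʳ w)) (trans (cong (w ⟨$⟩ʳ_) e) (inverseʳ w))

exchange-descent : (s : Word n) {i : Fin n} → Descent i ⟦ s ⟧ →
  ∃ λ s′ → s′ ⊆ s × length s ≡ suc (length s′) × ⟦ s′ ⟧ ≃ σ i · ⟦ s ⟧
exchange-descent s {i} (descent d) =
  strong-exchange s (s≤s (ℕ.≤-reflexive (toℕ-inject₁ i))) d

record Reduced (s : Word n) : Set where
  constructor reduced
  field minimal : (t : Word n) → ⟦ t ⟧ ≃ ⟦ s ⟧ → length s ≤ length t
open Reduced

Reduced-≡length : {s t : Word n} → Reduced s → Reduced t → ⟦ s ⟧ ≃ ⟦ t ⟧ → length s ≡ length t
Reduced-≡length {s = s} {t} rs rt p = ℕ.≤-antisym (minimal rs t (≃-sym p)) (minimal rt s p)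

Reduced-resp : {s t : Word n} → Reduced s → ⟦ s ⟧ ≃ ⟦ t ⟧ → length t ≤ length s → Reduced t
Reduced-resp rs p len =
  reduced λ r q → ≤-trans len (minimal rs r (≃-trans q (≃-sym p)))

Reduced-[] : Reduced {n} []
Reduced-[] = reduced λ _ _ → z≤n

-- Any word of the longer product has `i` as a descent, so the exchange property deletes a letter
-- and leaves a word of `⟦ s ⟧`.
Reduced-∷ : {i : Fin n} {s : Word n} → Reduced s → ¬ Descent i ⟦ s ⟧ → Reduced (i ∷ s)
Reduced-∷ {i = i} {s} rs ¬d = reduced bound
  where
  bound : ∀ t → ⟦ t ⟧ ≃ ⟦ i ∷ s ⟧ → suc (length s) ≤ length t
  bound t p with exchange-descent t {i} (Descent-resp (≃-sym p) (Descent-σ ¬d))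
  ... | t′ , _ , len , q = subst (suc (length s) ≤_) (sym len)
    (s≤s (minimal rs t′ (≃-trans q (≃-trans (·-congˡ (σ i) p) (σ-involutive i)))))

Reduced-tail : {i : Fin n} {s : Word n} → Reduced (i ∷ s) → Reduced s
Reduced-tail {i = i} r = reduced λ t p → ℕ.≤-pred (minimal r (i ∷ t) (·-congˡ (σ i) p))

Reduced⇒¬Descent : {i : Fin n} {s : Word n} → Reduced (i ∷ s) → ¬ Descent i ⟦ s ⟧
Reduced⇒¬Descent {i = i} {s} r d with exchange-descent s d
... | s′ , _ , len , q =
  <-irrefl refl (≤-trans (ℕ.m≤n⇒m≤1+n (ℕ.≤-reflexive (sym len))) (minimal r s′ q))

Reduced⇒Descent : {i : Fin n} {s : Word n} → Reduced (i ∷ s) → Descent i ⟦ i ∷ s ⟧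
Reduced⇒Descent r = Descent-σ (Reduced⇒¬Descent r)

Reduced-++ʳ : (s : Word n) {t : Word n} → Reduced (s ++ t) → Reduced t
Reduced-++ʳ []      r = r
Reduced-++ʳ (i ∷ s) r = Reduced-++ʳ s (Reduced-tail r)

Reduced-++ˡ : (s : Word n) {t : Word n} → Reduced (s ++ t) → Reduced s
Reduced-++ˡ s {t} r = reduced λ s′ p → ℕ.+-cancelʳ-≤ (length t) (length s) (length s′)
  (subst₂ _≤_ (length-++ s) (length-++ s′)
    (minimal r (s′ ++ t) (≃-trans (⟦++⟧ s′ t)
      (≃-trans (pointwise λ x → at p (⟦ t ⟧ ⟨$⟩ʳ x)) (≃-sym (⟦++⟧ s t))))))

-- The deletion property. That the result is a subword of `s` allows the order to be handled through
-- arbitrary subwords.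
reduce : (s : Word n) → ∃ λ s′ → s′ ⊆ s × Reduced s′ × ⟦ s′ ⟧ ≃ ⟦ s ⟧
reduce [] = [] , [] , Reduced-[] , ≃-refl
reduce (i ∷ s) with reduce s
... | s′ , s′⊆s , r , p with Descent? i ⟦ s′ ⟧
...   | no ¬d = i ∷ s′ , refl ∷ s′⊆s , Reduced-∷ r ¬d , ·-congˡ (σ i) p
...   | yes d with exchange-descent s′ d
...     | s″ , s″⊆s′ , len , q =
  s″ , i ∷ʳ ⊆-trans s″⊆s′ s′⊆s , reduced bound , ≃-trans q (·-congˡ (σ i) p)
  where
  bound : ∀ t → ⟦ t ⟧ ≃ ⟦ s″ ⟧ → length s″ ≤ length t
  bound t e = ℕ.≤-pred (subst (_≤ suc (length t)) len
    (minimal r (i ∷ t) (≃-trans (·-congˡ (σ i) (≃-trans e q)) (σ-involutive i))))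

-- Reducing `i ∷ s` gives an element without the descent `i`, so `i` can be put back in front.
Reduced-starting : {i : Fin n} (s : Word n) → Descent i ⟦ s ⟧ →
  ∃ λ t → Reduced (i ∷ t) × ⟦ i ∷ t ⟧ ≃ ⟦ s ⟧
Reduced-starting {i = i} s d with reduce (i ∷ s)
... | t , _ , r , p = t , Reduced-∷ r (¬Descent-σ d ∘ Descent-resp p) ,
                      ≃-trans (·-congˡ (σ i) p) (σ-involutive i)

private
  -- The upper letter is lowered one step at a time, by conjugating with the generator that swaps it
  -- with its predecessor.
  word-transpose-< : (k : ℕ) (a b : Fin (suc n)) → toℕ a < toℕ b → toℕ b ≤ k →
    ∃ λ s → ⟦ s ⟧ ≃ transpose a b
  word-transpose-< (suc k) a (suc b) a<b (s≤s b≤k) with a ≟ inject₁ b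
  ... | yes refl = b ∷ [] , ≃-refl
  ... | no a≢b with word-transpose-< k a (inject₁ b)
                     (ℕ.≤∧≢⇒< (subst (toℕ a ≤_) (sym (toℕ-inject₁ b)) (ℕ.≤-pred a<b)) (a≢b ∘ toℕ-injective))
                     (subst (_≤ k) (sym (toℕ-inject₁ b)) b≤k)
  ...   | s , p = b ∷ s ++ b ∷ [] , pointwise λ x → begin
    σ b ⟨$⟩ʳ (⟦ s ++ b ∷ [] ⟧ ⟨$⟩ʳ x)
      ≡⟨ cong (σ b ⟨$⟩ʳ_) (trans (at (⟦++⟧ s (b ∷ [])) x) (at p (σ b ⟨$⟩ʳ x))) ⟩
    σ b ⟨$⟩ʳ PC.transpose a (inject₁ b) (σ b ⟨$⟩ʳ x)
      ≡⟨ transpose-conj (σ b) a (inject₁ b) (σ b ⟨$⟩ʳ x) ⟩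
    PC.transpose (σ b ⟨$⟩ʳ a) (σ b ⟨$⟩ʳ inject₁ b) (σ b ⟨$⟩ʳ (σ b ⟨$⟩ʳ x))
      ≡⟨ cong₂ (λ c d → PC.transpose c d (σ b ⟨$⟩ʳ (σ b ⟨$⟩ʳ x)))
           (transpose-other a≢b (λ e → <-irrefl (cong toℕ e) a<b))
           (transpose-fst (inject₁ b) (suc b)) ⟩
    PC.transpose a (suc b) (σ b ⟨$⟩ʳ (σ b ⟨$⟩ʳ x))
      ≡⟨ cong (PC.transpose a (suc b)) (at (σ-involutive b {id}) x) ⟩
    PC.transpose a (suc b) x ∎
    where open ≡-Reasoning

word-transpose : (a b : Fin (suc n)) → ∃ λ s → ⟦ s ⟧ ≃ transpose a b
word-transpose a b with <-cmp (toℕ a) (toℕ b)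
... | tri< a<b _ _ = word-transpose-< (toℕ b) a b a<b ≤-refl
... | tri> _ _ b<a with word-transpose-< (toℕ a) b a b<a ≤-refl
...   | s , p = s , ≃-trans p (pointwise (transpose-comm b a))
word-transpose a b | tri≈ _ a≡b _ with toℕ-injective a≡b
... | refl = [] , pointwise λ x → case x ≟ a of λ where
  (yes refl) → sym (transpose-fst a a)
  (no x≢a)   → sym (transpose-other x≢a x≢a)

private
  word-eval : (xs : TranspositionList (suc n)) → ∃ λ s → ⟦ s ⟧ ≃ eval xs
  word-eval []             = [] , ≃-refl
  word-eval ((a , b) ∷ xs) with word-transpose a b | word-eval xs
  ... | s , p | t , q = t ++ s , ≃-trans (⟦++⟧ t s) (pointwise λ x →
    trans (at q (⟦ s ⟧ ⟨$⟩ʳ x)) (cong (eval xs ⟨$⟩ʳ_) (at p x)))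

  reducedWord-eval : (xs : TranspositionList (suc n)) {w : 𝔖 n} → eval xs ≃ w →
    ∃ λ s → Reduced s × ⟦ s ⟧ ≃ w
  reducedWord-eval xs p with word-eval xs
  ... | t , q with reduce t
  ...   | s , _ , r , e = s , r , ≃-trans e (≃-trans q p)

abstract
  -- Opaque, so that `len` never unfolds into a decomposition into transpositions; only the
  -- existence of a reduced word matters.
  reducedWord : (w : 𝔖 n) → ∃ λ s → Reduced s × ⟦ s ⟧ ≃ w
  reducedWord w = reducedWord-eval (decompose w) (pointwise (eval-decompose w))

-- Commutation and braid relations

record Commuting (i j : Fin n) : Set where
  field
    commute      : (w : 𝔖 n) → σ i · (σ j · w) ≃ σ j · (σ i · w)
    Descent-keep : {w : 𝔖 n} → Descent j w → Descent j (σ i · w)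

-- The descent fields say that when `i` and `j` are both descents of `w`, the letters `i`, `j`, `i`
-- can be stripped from the left one after the other, each time as a descent.
record Adjacent (i j : Fin n) : Set where
  field
    braid     : (w : 𝔖 n) → σ i · (σ j · (σ i · w)) ≃ σ j · (σ i · (σ j · w))
    consecutive : toℕ j ≡ suc (toℕ i) ⊎ toℕ i ≡ suc (toℕ j)
    Descent-1 : {w : 𝔖 n} → Descent i w → Descent j w → Descent j (σ i · w)
    Descent-2 : {w : 𝔖 n} → Descent i w → Descent j w → Descent i (σ j · (σ i · w))

open Commuting
open Adjacent

private
  commuting : {i j : Fin n} → i ≢ j → toℕ j ≢ suc (toℕ i) → toℕ i ≢ suc (toℕ j) → Commuting i j
  commuting {n} {i} {j} i≢j j≢si i≢sj = record
    { commute = λ w → pointwise λ x →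
        trans (transpose-conj (σ i) (inject₁ j) (suc j) (w ⟨$⟩ʳ x))
              (cong₂ (λ a b → PC.transpose a b (σ i ⟨$⟩ʳ (w ⟨$⟩ʳ x)))
                (transpose-other e₁ e₂) (transpose-other e₃ e₄))
    ; Descent-keep = λ {w} (descent d) → descent (subst₂ (λ a b → toℕ (w ⟨$⟩ˡ a) < toℕ (w ⟨$⟩ˡ b))
        (sym (transpose-other e₄ e₃)) (sym (transpose-other e₂ e₁)) d)
    }
    where
    e₁ : inject₁ j ≢ inject₁ i
    e₁ e = i≢j (toℕ-injective (trans (sym (toℕ-inject₁ i)) (trans (cong toℕ (sym e)) (toℕ-inject₁ j))))
    e₂ : inject₁ j ≢ suc i
    e₂ e = j≢si (trans (sym (toℕ-inject₁ j)) (cong toℕ e))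
    e₃ : suc j ≢ inject₁ i
    e₃ e = i≢sj (trans (sym (toℕ-inject₁ i)) (cong toℕ (sym e)))
    e₄ : suc j ≢ suc i
    e₄ refl = i≢j refl

  module Consecutive {i j : Fin n} (j≡si : toℕ j ≡ suc (toℕ i)) where

    meet : inject₁ j ≡ suc i
    meet = toℕ-injective (trans (toℕ-inject₁ j) j≡si)

    A≢B : inject₁ i ≢ inject₁ j
    A≢B e = inject₁≢suc i (trans e meet)

    A≢C : inject₁ i ≢ suc j
    A≢C e = ℕ.m≢1+m+n (toℕ i) {1} (begin
      toℕ i            ≡⟨ toℕ-inject₁ i ⟨
      toℕ (inject₁ i)  ≡⟨ cong toℕ e ⟩
      suc (toℕ j)      ≡⟨ cong suc j≡si ⟩
      suc (1 + toℕ i)  ≡⟨ cong suc (ℕ.+-comm 1 (toℕ i)) ⟩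
      suc (toℕ i + 1)  ∎)
      where open ≡-Reasoning

    C≢B : suc j ≢ suc i
    C≢B e = inject₁≢suc j (trans meet (sym e))

    -- Both sides are the transposition of the outer two, `inject₁ i` and `suc j`, of the three
    -- values involved, written as a conjugate in two ways.
    braid′ : (w : 𝔖 n) → σ i · (σ j · (σ i · w)) ≃ σ j · (σ i · (σ j · w))
    braid′ w = pointwise λ x → let y = w ⟨$⟩ʳ x in begin
      σ i ⟨$⟩ʳ (σ j ⟨$⟩ʳ (σ i ⟨$⟩ʳ y))
        ≡⟨ transpose-conj (σ i) (inject₁ j) (suc j) (σ i ⟨$⟩ʳ y) ⟩
      PC.transpose (σ i ⟨$⟩ʳ inject₁ j) (σ i ⟨$⟩ʳ suc j) (σ i ⟨$⟩ʳ (σ i ⟨$⟩ʳ y))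
        ≡⟨ cong₂ (λ a b → PC.transpose a b (σ i ⟨$⟩ʳ (σ i ⟨$⟩ʳ y)))
             (trans (cong (σ i ⟨$⟩ʳ_) meet) (transpose-snd (inject₁ i) (suc i)))
             (transpose-other (A≢C ∘ sym) C≢B) ⟩
      PC.transpose (inject₁ i) (suc j) (σ i ⟨$⟩ʳ (σ i ⟨$⟩ʳ y))
        ≡⟨ cong (PC.transpose (inject₁ i) (suc j)) (at (σ-involutive i {w}) x) ⟩
      PC.transpose (inject₁ i) (suc j) y
        ≡⟨ cong (PC.transpose (inject₁ i) (suc j)) (at (σ-involutive j {w}) x) ⟨
      PC.transpose (inject₁ i) (suc j) (σ j ⟨$⟩ʳ (σ j ⟨$⟩ʳ y))
        ≡⟨ cong₂ (λ a b → PC.transpose a b (σ j ⟨$⟩ʳ (σ j ⟨$⟩ʳ y)))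
             (transpose-other A≢B A≢C)
             (trans (cong (σ j ⟨$⟩ʳ_) (sym meet)) (transpose-fst (inject₁ j) (suc j))) ⟨
      PC.transpose (σ j ⟨$⟩ʳ inject₁ i) (σ j ⟨$⟩ʳ suc i) (σ j ⟨$⟩ʳ (σ j ⟨$⟩ʳ y))
        ≡⟨ transpose-conj (σ j) (inject₁ i) (suc i) (σ j ⟨$⟩ʳ y) ⟨
      σ j ⟨$⟩ʳ (σ i ⟨$⟩ʳ (σ j ⟨$⟩ʳ y)) ∎
      where open ≡-Reasoning

    iA : σ i ⟨$⟩ˡ inject₁ i ≡ suc i
    iA = transpose-snd (suc i) (inject₁ i)
    iB : σ i ⟨$⟩ˡ suc i ≡ inject₁ i
    iB = transpose-fst (suc i) (inject₁ i)
    iC : σ i ⟨$⟩ˡ suc j ≡ suc j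
    iC = transpose-other C≢B (A≢C ∘ sym)
    jA : σ j ⟨$⟩ˡ inject₁ i ≡ inject₁ i
    jA = transpose-other A≢C A≢B
    jB : σ j ⟨$⟩ˡ suc i ≡ suc j
    jB = trans (cong (σ j ⟨$⟩ˡ_) (sym meet)) (transpose-snd (suc j) (inject₁ j))
    jC : σ j ⟨$⟩ˡ suc j ≡ suc i
    jC = trans (transpose-fst (suc j) (inject₁ j)) meet

    module _ {w : 𝔖 n} (di : Descent i w) (dj : Descent j w) where

      private
        infix 4 _⋖_
        _⋖_ : Fin (suc n) → Fin (suc n) → Set
        a ⋖ b = toℕ (w ⟨$⟩ˡ a) < toℕ (w ⟨$⟩ˡ b)

        -- The two descents together say that the three consecutive values occur in reverse order of
        -- position; each claim below is one of the three resulting comparisons.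
        B<A : suc i ⋖ inject₁ i
        B<A = inversion di
        C<B : suc j ⋖ suc i
        C<B = subst (suc j ⋖_) meet (inversion dj)
        C<A : suc j ⋖ inject₁ i
        C<A = ℕ.<-trans C<B B<A

      j-after-i : Descent j (σ i · w)
      j-after-i = descent (subst₂ _⋖_ (sym iC) (sym (trans (cong (σ i ⟨$⟩ˡ_) meet) iB)) C<A)

      i-after-j : Descent i (σ j · w)
      i-after-j = descent (subst₂ _⋖_ (sym jB) (sym jA) C<A)

      i-after-ji : Descent i (σ j · (σ i · w))
      i-after-ji = descent (subst₂ _⋖_
        (sym (trans (cong (σ i ⟨$⟩ˡ_) jB) iC)) (sym (trans (cong (σ i ⟨$⟩ˡ_) jA) iA)) C<B)

      j-after-ij : Descent j (σ i · (σ j · w))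
      j-after-ij = descent (subst₂ _⋖_
        (sym (trans (cong (σ j ⟨$⟩ˡ_) iC) jC))
        (sym (trans (cong (λ a → σ j ⟨$⟩ˡ (σ i ⟨$⟩ˡ a)) meet) (trans (cong (σ j ⟨$⟩ˡ_) iB) jA))) B<A)

adjacent : {i j : Fin n} → toℕ j ≡ suc (toℕ i) → Adjacent i j
adjacent e = record
  { braid = braid′ ; consecutive = inj₁ e ; Descent-1 = j-after-i ; Descent-2 = i-after-ji }
  where open Consecutive e

Adjacent-sym : {i j : Fin n} → toℕ i ≡ suc (toℕ j) → Adjacent i j
Adjacent-sym e = record
  { braid = λ w → ≃-sym (braid′ w) ; consecutive = inj₂ e
  ; Descent-1 = λ d d′ → i-after-j d′ d ; Descent-2 = λ d d′ → j-after-ij d′ d }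
  where open Consecutive e

dihedral : {i j : Fin n} → i ≢ j → Commuting i j ⊎ Adjacent i j
dihedral {i = i} {j} i≢j with toℕ j ℕ.≟ suc (toℕ i) | toℕ i ℕ.≟ suc (toℕ j)
... | yes e | _     = inj₂ (adjacent e)
... | no _  | yes e = inj₂ (Adjacent-sym e)
... | no p  | no q  = inj₁ (commuting i≢j p q)

-- The Bruhat order

-- The subword `s` may be non-reduced, which gives the recursion of `Below-∷⁻` and `Below-∷⁺` on the
-- first letter; `reduce` recovers a reduced subword.
Below : Word n → 𝔖 n → Set
Below t u = ∃ λ s → s ⊆ t × ⟦ s ⟧ ≃ u

Below-resp : {t : Word n} {u v : 𝔖 n} → u ≃ v → Below t u → Below t v
Below-resp p (s , s⊆t , q) = s , s⊆t , ≃-trans q p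

Below-⊆ : {t t′ : Word n} {u : 𝔖 n} → t ⊆ t′ → Below t u → Below t′ u
Below-⊆ t⊆t′ (s , s⊆t , p) = s , ⊆-trans s⊆t t⊆t′ , p

Below-∷⁻ : {i : Fin n} {t : Word n} {u : 𝔖 n} → Below (i ∷ t) u → Below t u ⊎ Below t (σ i · u)
Below-∷⁻ (s , _ ∷ʳ s⊆t , p) = inj₁ (s , s⊆t , p)
Below-∷⁻ {i = i} (_ ∷ s , refl ∷ s⊆t , p) = inj₂ (s , s⊆t , σ-flip i p)

Below-∷⁺ : {i : Fin n} {t : Word n} {u : 𝔖 n} → Below t u ⊎ Below t (σ i · u) → Below (i ∷ t) u
Below-∷⁺ (inj₁ (s , s⊆t , p)) = s , _ ∷ʳ s⊆t , p
Below-∷⁺ {i = i} (inj₂ (s , s⊆t , p)) =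
  i ∷ s , refl ∷ s⊆t , ≃-trans (·-congˡ (σ i) p) (σ-involutive i)

Below-∷-cong : {i : Fin n} {t t′ : Word n} → (∀ {u} → Below t u → Below t′ u) →
  ∀ {u} → Below (i ∷ t) u → Below (i ∷ t′) u
Below-∷-cong f b with Below-∷⁻ b
... | inj₁ b′ = Below-∷⁺ (inj₁ (f b′))
... | inj₂ b′ = Below-∷⁺ (inj₂ (f b′))

private
  Below-commute : {i j : Fin n} → Commuting i j → ∀ {t u} →
    Below (i ∷ j ∷ t) u → Below (j ∷ i ∷ t) u
  Below-commute c (_ , _ ∷ʳ _ ∷ʳ s , p)         = _ , _ ∷ʳ _ ∷ʳ s , p
  Below-commute c (_ , _ ∷ʳ refl ∷ s , p)       = _ , refl ∷ _ ∷ʳ s , p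
  Below-commute c (_ , refl ∷ _ ∷ʳ s , p)       = _ , _ ∷ʳ refl ∷ s , p
  Below-commute c (_ ∷ _ ∷ s , refl ∷ refl ∷ s⊆t , p) =
    _ , refl ∷ refl ∷ s⊆t , ≃-trans (≃-sym (commute c ⟦ s ⟧)) p

  Below-braid : {i j : Fin n} → Adjacent i j → ∀ {t u} →
    Below (i ∷ j ∷ i ∷ t) u → Below (j ∷ i ∷ j ∷ t) u
  Below-braid a (_ , _ ∷ʳ _ ∷ʳ _ ∷ʳ s , p)       = _ , _ ∷ʳ _ ∷ʳ _ ∷ʳ s , p
  Below-braid a (_ , _ ∷ʳ _ ∷ʳ refl ∷ s , p)     = _ , _ ∷ʳ refl ∷ _ ∷ʳ s , p
  Below-braid a (_ , _ ∷ʳ refl ∷ _ ∷ʳ s , p)     = _ , refl ∷ _ ∷ʳ _ ∷ʳ s , p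
  Below-braid a (_ , _ ∷ʳ refl ∷ refl ∷ s , p)   = _ , refl ∷ refl ∷ _ ∷ʳ s , p
  Below-braid a (_ , refl ∷ _ ∷ʳ _ ∷ʳ s , p)     = _ , _ ∷ʳ refl ∷ _ ∷ʳ s , p
  -- The two copies of `i` cancel, so the empty choice of letters replaces them.
  Below-braid {i = i} a (_ , refl ∷ _ ∷ʳ refl ∷ s , p) =
    _ , _ ∷ʳ _ ∷ʳ _ ∷ʳ s , ≃-trans (≃-sym (σ-involutive i)) p
  Below-braid a (_ , refl ∷ refl ∷ _ ∷ʳ s , p)   = _ , _ ∷ʳ refl ∷ refl ∷ s , p
  Below-braid a (_ ∷ _ ∷ _ ∷ s , refl ∷ refl ∷ refl ∷ s⊆t , p) =
    _ , refl ∷ refl ∷ refl ∷ s⊆t , ≃-trans (≃-sym (braid a ⟦ s ⟧)) p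

  -- Matsumoto's argument: two reduced words of w starting with i and j can both be
  -- compared with words starting with the longest element of ⟨σ i , σ j⟩.
  Below-independent-≤ : (k : ℕ) {t t′ : Word n} → length t ≤ k →
    Reduced t → Reduced t′ → ⟦ t ⟧ ≃ ⟦ t′ ⟧ → ∀ {u} → Below t u → Below t′ u
  Below-independent-≤ k {[]} {[]} _ _ _ _ b = b
  Below-independent-≤ k {[]} {_ ∷ _} _ r r′ p b = case Reduced-≡length r r′ p of λ ()
  Below-independent-≤ k {_ ∷ _} {[]} _ r r′ p b = case Reduced-≡length r r′ p of λ ()
  Below-independent-≤ {n} (suc k) {i ∷ t} {j ∷ t′} (s≤s len) r r′ p {u} b with i ≟ j
  ... | yes refl = Below-∷-cong
    (Below-independent-≤ k len (Reduced-tail r) (Reduced-tail r′) (σ-cancel i p)) b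
  ... | no i≢j = go (dihedral i≢j)
    where
    len′ : length t′ ≤ k
    len′ = subst (_≤ k) (ℕ.suc-injective (Reduced-≡length r r′ p)) len

    di : Descent i ⟦ i ∷ t ⟧
    di = Reduced⇒Descent r

    dj : Descent j ⟦ i ∷ t ⟧
    dj = Descent-resp (≃-sym p) (Reduced⇒Descent r′)

    -- The passage from `i ∷ t` to `j ∷ t′` goes through `i ∷ x` and `j ∷ y`, which differ by one
    -- commutation or braid move `f`. The outer two passages keep the first letter and are recursive
    -- calls on the tails.
    via : (x y : Word n) → Reduced x → ⟦ x ⟧ ≃ ⟦ t ⟧ → length y ≡ length x → ⟦ y ⟧ ≃ ⟦ t′ ⟧ →
      (∀ {u} → Below (i ∷ x) u → Below (j ∷ y) u) → Below (j ∷ t′) u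
    via x y rx px ly py f =
      Below-∷-cong (Below-independent-≤ k (ℕ.≤-trans (ℕ.≤-reflexive leny) len′) ry (Reduced-tail r′) py)
        (f (Below-∷-cong (Below-independent-≤ k len (Reduced-tail r) rx (≃-sym px)) b))
      where
      leny : length y ≡ length t′
      leny = trans ly (trans (Reduced-≡length rx (Reduced-tail r) px)
               (ℕ.suc-injective (Reduced-≡length r r′ p)))
      ry : Reduced y
      ry = Reduced-resp (Reduced-tail r′) (≃-sym py) (ℕ.≤-reflexive leny)

    go : Commuting i j ⊎ Adjacent i j → Below (j ∷ t′) u
    go (inj₁ c) =
      let x , rx , px = Reduced-starting t (Descent-resp (σ-involutive i {⟦ t ⟧}) (Descent-keep c dj))
      in via (j ∷ x) (i ∷ x) rx px refl
        (σ-cancel j {⟦ i ∷ x ⟧} {⟦ t′ ⟧} (≃-trans (≃-sym (commute c ⟦ x ⟧)) (≃-trans (·-congˡ (σ i) px) p)))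
        (Below-commute c)
    go (inj₂ a) =
      let y , ry , py = Reduced-starting t (Descent-resp (σ-involutive i {⟦ t ⟧}) (Descent-1 a di dj))
          x , rx , px = Reduced-starting y (Descent-resp
            (≃-sym (σ-flip j {⟦ y ⟧} {σ i · ⟦ i ∷ t ⟧} (≃-trans py (≃-sym (σ-involutive i {⟦ t ⟧})))))
            (Descent-2 a di dj))
          px′ = ≃-trans (·-congˡ (σ j) px) py
      in via (j ∷ i ∷ x) (i ∷ j ∷ x)
        (Reduced-resp ry (≃-sym (·-congˡ (σ j) px))
          (ℕ.≤-reflexive (cong suc (Reduced-≡length rx (Reduced-tail ry) px))))
        px′ refl
        (σ-cancel j {⟦ i ∷ j ∷ x ⟧} {⟦ t′ ⟧}
          (≃-trans (≃-sym (braid a ⟦ x ⟧)) (≃-trans (·-congˡ (σ i) px′) p)))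
        (Below-braid a)

Below-independent : {t t′ : Word n} → Reduced t → Reduced t′ → ⟦ t ⟧ ≃ ⟦ t′ ⟧ →
  ∀ {u} → Below t u → Below t′ u
Below-independent {t = t} = Below-independent-≤ (length t) ≤-refl

infix 4 _≼_
-- By `Below-independent`, one reduced word of `w` is as good as all. Quantifying over all of them
-- lets each later argument choose the word that suits it, usually one starting with a given
-- descent.
record _≼_ (u w : 𝔖 n) : Set where
  constructor order
  field below : {t : Word n} → Reduced t → ⟦ t ⟧ ≃ w → Below t u
open _≼_

Below⇒≼ : {t : Word n} {u w : 𝔖 n} → Reduced t → ⟦ t ⟧ ≃ w → Below t u → u ≼ w
Below⇒≼ r p b = order λ r′ p′ → Below-independent r r′ (≃-trans p (≃-sym p′)) b

≼-reducedWord : {u w : 𝔖 n} → u ≼ w →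
  ∃₂ λ s t → Reduced s × Reduced t × ⟦ s ⟧ ≃ u × ⟦ t ⟧ ≃ w × s ⊆ t
≼-reducedWord {u = u} {w} u≼w with reducedWord w
... | t , rt , pt with below u≼w rt pt
...   | s , s⊆t , ps with reduce s
...     | s′ , s′⊆s , rs′ , p = s′ , t , rs′ , rt , ≃-trans p ps , pt , ⊆-trans s′⊆s s⊆t

≼⇒≤ᴮ : {u w : 𝔖 n} → u ≼ w → u ≤ᴮ w
≼⇒≤ᴮ u≼w with ≼-reducedWord u≼w
... | s , t , rs , rt , ps , pt , s⊆t = s , t ,
  (at ps , λ x p → minimal rs x (≃-trans (pointwise p) (≃-sym ps))) ,
  (at pt , λ x p → minimal rt x (≃-trans (pointwise p) (≃-sym pt))) , s⊆t

IsReduced⇒Reduced : {w : 𝔖 n} (s : Word n) → s IsReducedDecompositionOf w → Reduced s × ⟦ s ⟧ ≃ w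
IsReduced⇒Reduced s (p , m) =
  reduced (λ t q → m t (λ x → trans (at q x) (p x))) , pointwise p

≤ᴮ⇒≼ : {u w : 𝔖 n} → u ≤ᴮ w → u ≼ w
≤ᴮ⇒≼ {u = u} {w} (s , t , rs , rt , s⊆t) with IsReduced⇒Reduced {w = u} s rs | IsReduced⇒Reduced {w = w} t rt
... | _ , p | r , q = Below⇒≼ r q (s , s⊆t , p)

≼-refl : {w : 𝔖 n} → w ≼ w
≼-refl = order λ {t} _ p → t , ⊆-refl , p

≼-reflexive : {v w : 𝔖 n} → v ≃ w → v ≼ w
≼-reflexive p = order λ {t} _ q → t , ⊆-refl , ≃-trans q (≃-sym p)

≼-trans : {u v w : 𝔖 n} → u ≼ v → v ≼ w → u ≼ w
≼-trans u≼v v≼w with ≼-reducedWord v≼w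
... | s , t , rs , rt , ps , pt , s⊆t = Below⇒≼ rt pt (Below-⊆ s⊆t (below u≼v rs ps))

-- Length and the lifting property

len : 𝔖 n → ℕ
len w = length (proj₁ (reducedWord w))

Reduced⇒len : {t : Word n} {w : 𝔖 n} → Reduced t → ⟦ t ⟧ ≃ w → len w ≡ length t
Reduced⇒len {w = w} r p with reducedWord w
... | s , rs , ps = Reduced-≡length rs r (≃-trans ps (≃-sym p))

len-cong : {v w : 𝔖 n} → v ≃ w → len v ≡ len w
len-cong {w = w} p with reducedWord w
... | t , rt , pt = Reduced⇒len rt (≃-trans pt (≃-sym p))

≼⇒len≤ : {u w : 𝔖 n} → u ≼ w → len u ≤ len w
≼⇒len≤ u≼w with ≼-reducedWord u≼w
... | s , t , rs , rt , ps , pt , s⊆t =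
  subst₂ _≤_ (sym (Reduced⇒len rs ps)) (sym (Reduced⇒len rt pt)) (length-mono-≤ s⊆t)

≼∧len≥⇒≃ : {u w : 𝔖 n} → u ≼ w → len w ≤ len u → u ≃ w
≼∧len≥⇒≃ u≼w len≥ with ≼-reducedWord u≼w
... | s , t , rs , rt , ps , pt , s⊆t = ≃-trans (≃-sym ps) (subst (λ s → ⟦ s ⟧ ≃ _) (sym s≡t) pt)
  where
  s≡t : s ≡ t
  s≡t = ≋⇒≡ (toPointwise
    (ℕ.≤-antisym (length-mono-≤ s⊆t)
      (subst₂ _≤_ (Reduced⇒len rt pt) (Reduced⇒len rs ps) len≥)) s⊆t)

≼-antisym : {v w : 𝔖 n} → v ≼ w → w ≼ v → v ≃ w
≼-antisym v≼w w≼v = ≼∧len≥⇒≃ v≼w (≼⇒len≤ w≼v)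

≃? : (v w : 𝔖 n) → Dec (v ≃ w)
≃? v w = map′ pointwise at (all? λ x → (v ⟨$⟩ʳ x) ≟ (w ⟨$⟩ʳ x))

Below? : (t : Word n) (u : 𝔖 n) → Dec (Below t u)
Below? [] u = map′ (λ p → [] , [] , p) (λ { ([] , [] , p) → p }) (≃? ⟦ [] ⟧ u)
Below? (i ∷ t) u = map′ Below-∷⁺ Below-∷⁻ (Below? t u ⊎-dec Below? t (σ i · u))

infix 4 _≼?_
_≼?_ : (u w : 𝔖 n) → Dec (u ≼ w)
u ≼? w with reducedWord w
... | t , rt , pt = map′ (Below⇒≼ rt pt) (λ p → below p rt pt) (Below? t u)

module _ {i : Fin n} {w : 𝔖 n} where

  descend : Descent i w → ∃ λ t → Reduced (i ∷ t) × ⟦ i ∷ t ⟧ ≃ w × ⟦ t ⟧ ≃ σ i · w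
  descend d =
    let s , rs , ps = reducedWord w
        t , rt , pt = Reduced-starting s (Descent-resp (≃-sym ps) d)
    in t , rt , ≃-trans pt ps , σ-flip i {⟦ t ⟧} (≃-trans pt ps)

  len-Descent : Descent i w → len w ≡ suc (len (σ i · w))
  len-Descent d =
    let t , rt , pt , p = descend d
    in trans (Reduced⇒len rt pt) (cong suc (sym (Reduced⇒len (Reduced-tail rt) p)))

  σ-≼ : Descent i w → σ i · w ≼ w
  σ-≼ d = let t , rt , pt , p = descend d in Below⇒≼ rt pt (t , i ∷ʳ ⊆-refl , p)

len-¬Descent : {i : Fin n} {w : 𝔖 n} → ¬ Descent i w → len (σ i · w) ≡ suc (len w)
len-¬Descent {i = i} ¬d = trans (len-Descent (Descent-σ ¬d)) (cong suc (len-cong (σ-involutive i)))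

≼-σ : {i : Fin n} {w : 𝔖 n} → ¬ Descent i w → w ≼ σ i · w
≼-σ {i = i} ¬d = ≼-trans (≼-reflexive (≃-sym (σ-involutive i))) (σ-≼ (Descent-σ ¬d))

-- All three are read off a reduced word of `w` starting with `i`, according to whether a subword
-- for `u` uses that first letter.
module _ {i : Fin n} {u w : 𝔖 n} (d : Descent i w) (u≼w : u ≼ w) where

  Descent-closed : σ i · u ≼ w
  Descent-closed = let t , rt , pt , p = descend d in
    Below⇒≼ rt pt (Below-∷⁺ (case Below-∷⁻ (below u≼w rt pt) of λ where
      (inj₁ b) → inj₂ (Below-resp (≃-sym (σ-involutive i)) b)
      (inj₂ b) → inj₁ b))

  lifting : ¬ Descent i u → u ≼ σ i · w
  lifting ¬du = let t , rt , pt , p = descend d in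
    case Below-∷⁻ (below u≼w rt pt) of λ where
      (inj₁ b) → Below⇒≼ (Reduced-tail rt) p b
      (inj₂ b) → ≼-trans (≼-σ ¬du) (Below⇒≼ (Reduced-tail rt) p b)

  σ-mono-≼ : Descent i u → σ i · u ≼ σ i · w
  σ-mono-≼ du = let t , rt , pt , p = descend d in
    case Below-∷⁻ (below u≼w rt pt) of λ where
      (inj₁ b) → ≼-trans (σ-≼ du) (Below⇒≼ (Reduced-tail rt) p b)
      (inj₂ b) → Below⇒≼ (Reduced-tail rt) p b

σ-raise-≼ : {i : Fin n} {u w : 𝔖 n} → ¬ Descent i w → u ≼ w → σ i · u ≼ σ i · w
σ-raise-≼ ¬d u≼w = Descent-closed (Descent-σ ¬d) (≼-trans u≼w (≼-σ ¬d))

-- The form used in inductions on a reduced word `i ∷ t`, with `y` the product of `t`: the descent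
-- `i` decides whether `u` or `σ i · u` passes down to `y`.
module _ {i : Fin n} {u y : 𝔖 n} (¬d : ¬ Descent i y) where

  σ-drop : ¬ Descent i u → u ≼ σ i · y → u ≼ y
  σ-drop ¬du u≼ = ≼-trans (lifting (Descent-σ ¬d) u≼ ¬du) (≼-reflexive (σ-involutive i))

  σ-drop-σ : Descent i u → u ≼ σ i · y → σ i · u ≼ y
  σ-drop-σ du u≼ = ≼-trans (σ-mono-≼ (Descent-σ ¬d) u≼ du) (≼-reflexive (σ-involutive i))

σ-≼⁻ : {i : Fin n} {u v : 𝔖 n} → ¬ Descent i v → σ i · u ≼ v → u ≼ σ i · v
σ-≼⁻ {i = i} ¬d p = ≼-trans (≼-reflexive (≃-sym (σ-involutive i))) (σ-raise-≼ ¬d p)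

σ-closed⁻ : {i : Fin n} {u v : 𝔖 n} → Descent i v → σ i · u ≼ v → u ≼ v
σ-closed⁻ {i = i} d p = ≼-trans (≼-reflexive (≃-sym (σ-involutive i))) (Descent-closed d p)

len-⟦⟧ : {t : Word n} → Reduced t → len ⟦ t ⟧ ≡ length t
len-⟦⟧ r = Reduced⇒len r ≃-refl

-- Gradedness and intervals of rank two

private
  -- If `i` is no descent of `u`, then `⟦ t ⟧` itself is a coatom above `u`. Otherwise a coatom `v`
  -- of `⟦ t ⟧` above `σ i · u` is multiplied by `σ i`, unless `i` is a descent of `v`; in that case
  -- `u ≼ v`, and `⟦ t ⟧` serves again.
  coatom-word : (t : Word n) → Reduced t → {u : 𝔖 n} → u ≼ ⟦ t ⟧ → len u < length t →
    ∃ λ v → u ≼ v × v ≼ ⟦ t ⟧ × length t ≡ suc (len v)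
  coatom-word {n} (i ∷ t) r {u} u≼ (s≤s len≤) = go (Descent? i u)
    where
    ¬d : ¬ Descent i ⟦ t ⟧
    ¬d = Reduced⇒¬Descent r

    rt : Reduced t
    rt = Reduced-tail r

    go : Dec (Descent i u) → ∃ λ v → u ≼ v × v ≼ ⟦ i ∷ t ⟧ × suc (length t) ≡ suc (len v)
    go (no ¬du) = ⟦ t ⟧ , σ-drop ¬d ¬du u≼ , ≼-σ ¬d , cong suc (sym (len-⟦⟧ rt))
    go (yes du) = case coatom-word t rt (σ-drop-σ ¬d du u≼)
                         (subst (_≤ length t) (len-Descent du) len≤) of λ where
        (v , u≼v , v≼t , eq) → lift (Descent? i v) u≼v v≼t eq
      where
      lift : ∀ {v} → Dec (Descent i v) → σ i · u ≼ v → v ≼ ⟦ t ⟧ → length t ≡ suc (len v) →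
        ∃ λ v → u ≼ v × v ≼ ⟦ i ∷ t ⟧ × suc (length t) ≡ suc (len v)
      lift (no ¬dv) u≼v v≼t eq =
        _ , σ-≼⁻ ¬dv u≼v , σ-raise-≼ ¬d v≼t , cong suc (trans eq (sym (len-¬Descent ¬dv)))
      lift (yes dv) u≼v v≼t eq =
        ⟦ t ⟧ , ≼-trans (σ-closed⁻ dv u≼v) v≼t , ≼-σ ¬d , cong suc (sym (len-⟦⟧ rt))

coatom : {u w : 𝔖 n} → u ≼ w → len u < len w → ∃ λ v → u ≼ v × v ≼ w × len w ≡ suc (len v)
coatom {u = u} {w} u≼w u<w = case reducedWord w of λ where
  (t , rt , pt) → case coatom-word t rt (≼-trans u≼w (≼-reflexive (≃-sym pt)))
                         (subst (len u <_) (Reduced⇒len rt pt) u<w) of λ where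
    (v , u≼v , v≼t , eq) → v , u≼v , ≼-trans v≼t (≼-reflexive pt) , trans (Reduced⇒len rt pt) eq

open module Bruhat {n} = Ranked (_≃_ {n}) _≼_ len
open Between

private
  -- If `i` is no descent of `u`, the intermediate elements are `y` and `σ i · u`. Otherwise those
  -- of the interval from `σ i · u` to `y` are matched with those wanted.
  diamond-word : (t : Word n) → Reduced t → {u : 𝔖 n} → u ≼ ⟦ t ⟧ → length t ≡ 2 + len u →
    Diamond u ⟦ t ⟧
  diamond-word {n} (i ∷ t) r {u} u≼ eq = go (Descent? i u)
    where
    y : 𝔖 n
    y = ⟦ t ⟧

    rt : Reduced t
    rt = Reduced-tail r

    ¬dy : ¬ Descent i y
    ¬dy = Reduced⇒¬Descent r

    len-y : len y ≡ suc (len u)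
    len-y = trans (len-⟦⟧ rt) (ℕ.suc-injective eq)

    same-rank : ∀ {z} → z ≼ y → len z ≡ suc (len u) → z ≃ y
    same-rank z≼y e = ≼∧len≥⇒≃ z≼y (ℕ.≤-reflexive (trans len-y (sym e)))

    y-between : u ≼ y → Between u (σ i · y) y
    y-between u≼y = between u≼y (≼-σ ¬dy) len-y

    go : Dec (Descent i u) → Diamond u (σ i · y)
    go (no ¬du) = record
      { left          = y
      ; right         = σ i · u
      ; left-between  = y-between u≼y
      ; right-between = between (≼-σ ¬du) (σ-raise-≼ ¬dy u≼y) (len-¬Descent ¬du)
      ; distinct      = λ p → ¬dy (Descent-resp (≃-sym p) (Descent-σ ¬du))
      ; exhaustive    = exhaustive-no
      }
      where
      u≼y : u ≼ y
      u≼y = σ-drop ¬dy ¬du u≼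

      exhaustive-no : ∀ z → Between u (σ i · y) z → z ≃ y ⊎ z ≃ σ i · u
      exhaustive-no z (between u≼z z≼ e) = case Descent? i z of λ where
        (no ¬dz) → inj₁ (same-rank (σ-drop ¬dy ¬dz z≼) e)
        (yes dz) → inj₂ (σ-flip i {z} {u} (≃-sym (≼∧len≥⇒≃ (lifting dz u≼z ¬du)
          (ℕ.≤-reflexive (ℕ.suc-injective (trans (sym (len-Descent dz)) e))))))
    go (yes du) = lift (diamond-word t rt (σ-drop-σ ¬dy du u≼) (trans (ℕ.suc-injective eq) (cong suc len-u)))
      where
      len-u : len u ≡ suc (len (σ i · u))
      len-u = len-Descent du

      -- The matching is multiplication by `σ i`, with one exception: an intermediate `z′` having
      -- the descent `i` must be `u`, the lower end of the new interval, and is matched with `y`,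
      -- the upper end of the old one.
      data Moved (z′ z : 𝔖 n) : Set where
        raised : ¬ Descent i z′ → z ≃ σ i · z′ → Moved z′ z
        jumped : Descent i z′ → z′ ≃ u → z ≃ y → Moved z′ z

      move : ∀ {z′} → Dec (Descent i z′) → Between (σ i · u) y z′ →
        ∃ λ z → Between u (σ i · y) z × Moved z′ z
      move (no ¬dz′) (between u′≼z′ z′≼y e) = _ ,
        between (σ-≼⁻ ¬dz′ u′≼z′) (σ-raise-≼ ¬dy z′≼y)
          (trans (len-¬Descent ¬dz′) (cong suc (trans e (sym len-u)))) ,
        raised ¬dz′ ≃-refl
      move (yes dz′) (between u′≼z′ z′≼y e) = y , y-between (≼-trans u≼z′ z′≼y) ,
        jumped dz′ (≃-sym (≼∧len≥⇒≃ u≼z′ (ℕ.≤-reflexive (trans e (sym len-u))))) ≃-refl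
        where u≼z′ = σ-closed⁻ dz′ u′≼z′

      unmove : ∀ {z} → Dec (Descent i z) → Between u (σ i · y) z →
        ∃ λ z′ → Between (σ i · u) y z′ × Moved z′ z
      unmove (yes dz) (between u≼z z≼ e) = _ ,
        between (σ-mono-≼ dz u≼z du) (σ-drop-σ ¬dy dz z≼)
          (ℕ.suc-injective (trans (sym (len-Descent dz)) (trans e (cong suc len-u)))) ,
        raised (¬Descent-σ dz) (≃-sym (σ-involutive i))
      unmove (no ¬dz) (between u≼z z≼ e) =
        u , between (σ-≼ du) (≼-trans u≼z z≼y) len-u , jumped du ≃-refl (same-rank z≼y e)
        where z≼y = σ-drop ¬dy ¬dz z≼

      Moved-functional : ∀ {x z′ z₁ z₂} → x ≃ z′ → Moved x z₁ → Moved z′ z₂ → z₁ ≃ z₂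
      Moved-functional e (raised _ p)   (raised _ q)   = ≃-trans p (≃-trans (·-congˡ (σ i) e) (≃-sym q))
      Moved-functional e (raised ¬d _)  (jumped d _ _) = contradiction (Descent-resp (≃-sym e) d) ¬d
      Moved-functional e (jumped d _ _) (raised ¬d _)  = contradiction (Descent-resp e d) ¬d
      Moved-functional e (jumped _ _ p) (jumped _ _ q) = ≃-trans p (≃-sym q)

      Moved-injective : ∀ {z₁′ z₂′ z₁ z₂} → z₁ ≃ z₂ → Moved z₁′ z₁ → Moved z₂′ z₂ → z₁′ ≃ z₂′
      Moved-injective e (raised _ p)   (raised _ q)   =
        σ-cancel i (≃-trans (≃-sym p) (≃-trans e q))
      Moved-injective e (raised ¬d p)  (jumped _ _ q) =
        contradiction (Descent-resp (≃-trans (≃-sym p) (≃-trans e q)) (Descent-σ ¬d)) ¬dy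
      Moved-injective e (jumped _ _ p) (raised ¬d q)  =
        contradiction (Descent-resp (≃-trans (≃-sym q) (≃-trans (≃-sym e) p)) (Descent-σ ¬d)) ¬dy
      Moved-injective e (jumped _ p _) (jumped _ q _) = ≃-trans p (≃-sym q)

      lift : Diamond (σ i · u) y → Diamond u (σ i · y)
      lift d = build (move (Descent? i left) left-between) (move (Descent? i right) right-between)
        where
        open Diamond d

        build : (∃ λ z → Between u (σ i · y) z × Moved left z) →
                (∃ λ z → Between u (σ i · y) z × Moved right z) → Diamond u (σ i · y)
        build (l , l-between , l-moved) (r , r-between , r-moved) = record
          { left          = l
          ; right         = r
          ; left-between  = l-between
          ; right-between = r-between
          ; distinct      = λ p → distinct (Moved-injective p l-moved r-moved)
          ; exhaustive    = λ z b → trace (unmove (Descent? i z) b)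
          }
          where
          trace : ∀ {z} → (∃ λ z′ → Between (σ i · u) y z′ × Moved z′ z) → z ≃ l ⊎ z ≃ r
          trace (z′ , b′ , z-moved) = case exhaustive z′ b′ of λ where
            (inj₁ p) → inj₁ (Moved-functional p z-moved l-moved)
            (inj₂ p) → inj₂ (Moved-functional p z-moved r-moved)

Between-resp : {u v w z : 𝔖 n} → v ≃ w → Between u v z → Between u w z
Between-resp p (between l h e) = between l (≼-trans h (≼-reflexive p)) e

Diamond-resp : {u v w : 𝔖 n} → v ≃ w → Diamond u v → Diamond u w
Diamond-resp p d = record
  { left          = left
  ; right         = right
  ; left-between  = Between-resp p left-between
  ; right-between = Between-resp p right-between
  ; distinct      = distinct
  ; exhaustive    = λ z b → exhaustive z (Between-resp (≃-sym p) b)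
  }
  where
  open Diamond d
diamond : {u w : 𝔖 n} → u ≼ w → len w ≡ 2 + len u → Diamond u w
diamond u≼w eq = case reducedWord _ of λ where
  (t , rt , pt) → Diamond-resp pt (diamond-word t rt (≼-trans u≼w (≼-reflexive (≃-sym pt)))
                                     (trans (sym (Reduced⇒len rt pt)) eq))

-- Letters of a word and products of distinct generators

private
  σ-preserves-≤ : {i j : Fin n} → j ≢ i → (x : Fin (suc n)) → toℕ x ≤ toℕ i →
    toℕ (σ j ⟨$⟩ˡ x) ≤ toℕ i
  σ-preserves-≤ {i = i} {j} j≢i x x≤i with x ≟ suc j
  ... | yes refl = subst (_≤ toℕ i) (sym (toℕ-inject₁ j)) (ℕ.<⇒≤ x≤i)
  ... | no _ with x ≟ inject₁ j
  ...   | yes refl = ℕ.≤∧≢⇒< (subst (_≤ toℕ i) (toℕ-inject₁ j) x≤i) (j≢i ∘ toℕ-injective)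
  ...   | no _     = x≤i

  σ-preserves-> : {i j : Fin n} → j ≢ i → (x : Fin (suc n)) → toℕ i < toℕ x →
    toℕ i < toℕ (σ j ⟨$⟩ˡ x)
  σ-preserves-> {i = i} {j} j≢i x i<x with x ≟ suc j
  ... | yes refl = subst (toℕ i <_) (sym (toℕ-inject₁ j))
    (ℕ.≤∧≢⇒< (ℕ.≤-pred i<x) (λ e → j≢i (toℕ-injective (sym e))))
  ... | no _ with x ≟ inject₁ j
  ...   | yes refl = ℕ.m<n⇒m<1+n (subst (toℕ i <_) (toℕ-inject₁ j) i<x)
  ...   | no _     = i<x

  word-preserves-≤ : {i : Fin n} (s : Word n) → i ∉ˡ s → (x : Fin (suc n)) → toℕ x ≤ toℕ i →
    toℕ (⟦ s ⟧ ⟨$⟩ˡ x) ≤ toℕ i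
  word-preserves-≤ [] _ x x≤i = x≤i
  word-preserves-≤ (j ∷ s) i∉ x x≤i =
    word-preserves-≤ s (i∉ ∘ there) _ (σ-preserves-≤ (i∉ ∘ here ∘ sym) x x≤i)

  word-preserves-> : {i : Fin n} (s : Word n) → i ∉ˡ s → (x : Fin (suc n)) → toℕ i < toℕ x →
    toℕ i < toℕ (⟦ s ⟧ ⟨$⟩ˡ x)
  word-preserves-> [] _ x i<x = i<x
  word-preserves-> (j ∷ s) i∉ x i<x =
    word-preserves-> s (i∉ ∘ there) _ (σ-preserves-> (i∉ ∘ here ∘ sym) x i<x)

-- A word without `i` lies in the parabolic subgroup that permutes the values up to `i`, and those
-- beyond, among themselves.
∉⇒¬Descent : {i : Fin n} (s : Word n) → i ∉ˡ s → ¬ Descent i ⟦ s ⟧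
∉⇒¬Descent {i = i} s i∉s (descent d) = <-irrefl refl (begin-strict
  toℕ i                        <⟨ word-preserves-> s i∉s (suc i) ≤-refl ⟩
  toℕ (⟦ s ⟧ ⟨$⟩ˡ suc i)       <⟨ d ⟩
  toℕ (⟦ s ⟧ ⟨$⟩ˡ inject₁ i)   ≤⟨ word-preserves-≤ s i∉s (inject₁ i) (ℕ.≤-reflexive (toℕ-inject₁ i)) ⟩
  toℕ i                        ∎)
  where open ℕ.≤-Reasoning

_∈?_ : (i : Fin n) (s : Word n) → Dec (i ∈ˡ s)
_∈?_ = DecMembership._∈?_ _≟_

Descent⇒∈ : {i : Fin n} (s : Word n) → Descent i ⟦ s ⟧ → i ∈ˡ s
Descent⇒∈ {i = i} s d with i ∈? s
... | yes i∈s = i∈s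
... | no i∉s  = contradiction d (∉⇒¬Descent s i∉s)

Below-Descent⇒∈ : {i : Fin n} {t : Word n} {u : 𝔖 n} → Below t u → Descent i u → i ∈ˡ t
Below-Descent⇒∈ (s , s⊆t , p) d = lookup s⊆t (Descent⇒∈ s (Descent-resp (≃-sym p) d))

Reduced-[_] : (i : Fin n) → Reduced (i ∷ [])
Reduced-[ i ] = Reduced-∷ Reduced-[] (∉⇒¬Descent [] λ ())

⟦[_]⟧ : (i : Fin n) → ⟦ i ∷ [] ⟧ ≃ σ i
⟦[ i ]⟧ = pointwise λ _ → refl

len-σ : (i : Fin n) → len (σ i) ≡ 1
len-σ i = Reduced⇒len Reduced-[ i ] ⟦[ i ]⟧

module _ {t : Word n} {w : 𝔖 n} (rt : Reduced t) (pt : ⟦ t ⟧ ≃ w) {i : Fin n} where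

  ∈⇒σ≼ : i ∈ˡ t → σ i ≼ w
  ∈⇒σ≼ i∈t = Below⇒≼ rt pt (i ∷ [] , from∈ i∈t , ⟦[ i ]⟧)

  σ≼⇒∈ : σ i ≼ w → i ∈ˡ t
  σ≼⇒∈ σ≼w = Below-Descent⇒∈ (below σ≼w rt pt) (Descent-resp ⟦[ i ]⟧ (Reduced⇒Descent Reduced-[ i ]))

Unique⇒∉ : {i : Fin n} {s : Word n} → Unique (i ∷ s) → i ∉ˡ s
Unique⇒∉ (i≢ ∷ _) = All.All¬⇒¬Any i≢

Unique⇒Reduced : {s : Word n} → Unique s → Reduced s
Unique⇒Reduced [] = Reduced-[]
Unique⇒Reduced {s = i ∷ s} un@(_ ∷ uniq) =
  Reduced-∷ (Unique⇒Reduced uniq) (∉⇒¬Descent s (Unique⇒∉ un))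

-- As `i` does not occur in `t`, no element below `⟦ t ⟧` has the descent `i`. This descent
-- therefore serves as the coordinate that records the use of the letter `i`.
distinct⇒BooleanIdeal : {t : Word n} → Unique t → BooleanIdeal _≼_ ⟦ t ⟧ (length t)
distinct⇒BooleanIdeal {t = []} [] = record
  { φ        = λ _ → []
  ; mono     = λ _ _ _ → λ ()
  ; cancel   = λ x≼id y≼id _ → ≼-trans x≼id (id≼ y≼id)
  ; preimage = λ { [] → ⟦ [] ⟧ , ≼-refl , refl }
  }
  where
  id≼ : {y : 𝔖 n} → y ≼ ⟦ [] ⟧ → ⟦ [] ⟧ ≼ y
  id≼ y≼id = case below y≼id Reduced-[] ≃-refl of λ { ([] , [] , p) → ≼-reflexive p }
distinct⇒BooleanIdeal {n} {t = i ∷ t} un@(_ ∷ uniq) = record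
  { φ        = λ x → φᵈ (Descent? i x)
  ; mono     = λ {x} {y} → monoᵈ (Descent? i x) (Descent? i y)
  ; cancel   = λ {x} {y} → cancelᵈ (Descent? i x) (Descent? i y)
  ; preimage = preimageᵈ
  }
  where
  open BooleanIdeal (distinct⇒BooleanIdeal uniq)

  i∉t : i ∉ˡ t
  i∉t = Unique⇒∉ un

  ¬d : ¬ Descent i ⟦ t ⟧
  ¬d = ∉⇒¬Descent t i∉t

  ≼t⇒¬Descent : ∀ {x} → x ≼ ⟦ t ⟧ → ¬ Descent i x
  ≼t⇒¬Descent x≼t d = i∉t (Below-Descent⇒∈ (below x≼t (Unique⇒Reduced uniq) ≃-refl) d)

  φᵈ : ∀ {x} → Dec (Descent i x) → Subset (suc (length t))
  φᵈ {x} (yes _) = inside ∷ φ (σ i · x)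
  φᵈ {x} (no _)  = outside ∷ φ x

  monoᵈ : ∀ {x y} (dx : Dec (Descent i x)) (dy : Dec (Descent i y)) →
    x ≼ ⟦ i ∷ t ⟧ → y ≼ ⟦ i ∷ t ⟧ → x ≼ y → φᵈ dx ⊆ˢ φᵈ dy
  monoᵈ (yes dx) (yes dy) x≼ y≼ x≼y = s⊆s (mono (σ-drop-σ ¬d dx x≼) (σ-drop-σ ¬d dy y≼) (σ-mono-≼ dy x≼y dx))
  monoᵈ (no ¬dx) (no ¬dy) x≼ y≼ x≼y = s⊆s (mono (σ-drop ¬d ¬dx x≼) (σ-drop ¬d ¬dy y≼) x≼y)
  monoᵈ (no ¬dx) (yes dy) x≼ y≼ x≼y = out⊆ (mono (σ-drop ¬d ¬dx x≼) (σ-drop-σ ¬d dy y≼) (lifting dy x≼y ¬dx))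
  -- Without the descent, `y` lies below `⟦ t ⟧`, hence so does `x`.
  monoᵈ (yes dx) (no ¬dy) x≼ y≼ x≼y = contradiction dx (≼t⇒¬Descent (≼-trans x≼y (σ-drop ¬d ¬dy y≼)))

  cancelᵈ : ∀ {x y} (dx : Dec (Descent i x)) (dy : Dec (Descent i y)) →
    x ≼ ⟦ i ∷ t ⟧ → y ≼ ⟦ i ∷ t ⟧ → φᵈ dx ⊆ˢ φᵈ dy → x ≼ y
  cancelᵈ (yes dx) (yes dy) x≼ y≼ φ⊆ = σ-closed⁻ dy
    (≼-trans (cancel (σ-drop-σ ¬d dx x≼) (σ-drop-σ ¬d dy y≼) (drop-∷-⊆ φ⊆)) (σ-≼ dy))
  cancelᵈ (no ¬dx) (no ¬dy) x≼ y≼ φ⊆ = cancel (σ-drop ¬d ¬dx x≼) (σ-drop ¬d ¬dy y≼) (drop-∷-⊆ φ⊆)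
  cancelᵈ (no ¬dx) (yes dy) x≼ y≼ φ⊆ =
    ≼-trans (cancel (σ-drop ¬d ¬dx x≼) (σ-drop-σ ¬d dy y≼) (drop-∷-⊆ φ⊆)) (σ-≼ dy)
  cancelᵈ (yes dx) (no ¬dy) x≼ y≼ φ⊆ = case φ⊆ {zero} here of λ ()

  φ-outside : ∀ {x} (dx : Dec (Descent i x)) → ¬ Descent i x → φᵈ dx ≡ outside ∷ φ x
  φ-outside (yes dx) ¬dx = contradiction dx ¬dx
  φ-outside (no _)   _   = refl

  φ-inside : ∀ {x} (dx : Dec (Descent i x)) → Descent i x → φᵈ dx ≡ inside ∷ φ (σ i · x)
  φ-inside (yes _)  _  = refl
  φ-inside (no ¬dx) dx = contradiction dx ¬dx

  φ-resp : ∀ {x y} → x ≼ ⟦ t ⟧ → y ≃ x → φ y ≡ φ x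
  φ-resp x≼t p = ⊆-antisym (mono y≼t x≼t (≼-reflexive p)) (mono x≼t y≼t (≼-reflexive (≃-sym p)))
    where y≼t = ≼-trans (≼-reflexive p) x≼t

  preimageᵈ : ∀ S → ∃ λ x → x ≼ ⟦ i ∷ t ⟧ × φᵈ (Descent? i x) ≡ S
  preimageᵈ (outside ∷ S) = case preimage S of λ where
    (x , x≼t , eq) → x , ≼-trans x≼t (≼-σ ¬d) ,
      trans (φ-outside (Descent? i x) (≼t⇒¬Descent x≼t)) (cong (outside ∷_) eq)
  preimageᵈ (inside ∷ S) = case preimage S of λ where
    (x , x≼t , eq) → σ i · x , σ-raise-≼ ¬d x≼t ,
      trans (φ-inside (Descent? i (σ i · x)) (Descent-σ (≼t⇒¬Descent x≼t)))
            (cong (inside ∷_) (trans (φ-resp x≼t (σ-involutive i)) eq))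

-- Boolean intervals

module _ (P : RawRelation 0ℓ 0ℓ 0ℓ) where

  open RawRelation P using (Carrier) renaming (_≈_ to _≈ᴾ_; _∼_ to _≤ᴾ_)

  -- `P` carries no axioms, so the equivalence and order laws are pulled back along `f` together
  -- with union and intersection.
  boolean⇒distributive : IsBoolean P → FormsDistributiveLattice P
  boolean⇒distributive (m , f , iso) = _∨_ , _∧_ , record
    { isLattice = record
      { isPartialOrder = record
        { isPreorder = record
          { isEquivalence = record
            { refl  = injective refl
            ; sym   = λ p → injective (sym (f-cong p))
            ; trans = λ p q → injective (trans (f-cong p) (f-cong q))
            }
          ; reflexive = λ p → cancel (⊆ˢ-reflexive (f-cong p))
          ; trans     = λ p q → cancel (⊆ˢ-trans (mono p) (mono q))
          }
        ; antisym = λ p q → injective (⊆-antisym (mono p) (mono q))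
        }
      ; supremum = λ x y →
          cancel (⊆ˢ-trans (p⊆p∪q (f y)) (⊆ˢ-reflexive (sym (f-g _)))) ,
          cancel (⊆ˢ-trans (q⊆p∪q (f x) (f y)) (⊆ˢ-reflexive (sym (f-g _)))) ,
          λ z x≤z y≤z → cancel (⊆ˢ-trans (⊆ˢ-reflexive (f-g _)) λ e → case x∈p∪q⁻ (f x) (f y) e of λ where
            (inj₁ e) → mono x≤z e
            (inj₂ e) → mono y≤z e)
      ; infimum = λ x y →
          cancel (⊆ˢ-trans (⊆ˢ-reflexive (f-g _)) (p∩q⊆p (f x) (f y))) ,
          cancel (⊆ˢ-trans (⊆ˢ-reflexive (f-g _)) (p∩q⊆q (f x) (f y))) ,
          λ z z≤x z≤y → cancel (⊆ˢ-trans (λ e → x∈p∩q⁺ (mono z≤x e , mono z≤y e))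
                                         (⊆ˢ-reflexive (sym (f-g _))))
      }
    ; ∧-distribˡ-∨ = λ x y z → injective (begin
        f (x ∧ (y ∨ z))              ≡⟨ f-g _ ⟩
        f x ∩ f (y ∨ z)              ≡⟨ cong (f x ∩_) (f-g _) ⟩
        f x ∩ (f y ∪ f z)            ≡⟨ ∩-distribˡ-∪ (f x) (f y) (f z) ⟩
        (f x ∩ f y) ∪ (f x ∩ f z)    ≡⟨ cong₂ _∪_ (f-g _) (f-g _) ⟨
        f (x ∧ y) ∪ f (x ∧ z)        ≡⟨ f-g _ ⟨
        f ((x ∧ y) ∨ (x ∧ z))        ∎)
    }
    where
    open IsOrderIsomorphism iso using (injective; mono; cancel; surjective) renaming (cong to f-cong)
    open ≡-Reasoning

    g : Subset m → Carrier
    g S = proj₁ (surjective S)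

    f-g : ∀ S → f (g S) ≡ S
    f-g S = proj₂ (surjective S) (injective refl)

    _∨_ _∧_ : Carrier → Carrier → Carrier
    x ∨ y = g (f x ∪ f y)
    x ∧ y = g (f x ∩ f y)

  distributive⇒modular : FormsDistributiveLattice P → FormsModularLattice P
  distributive⇒modular (_∨_ , _∧_ , D) = _∨_ , _∧_ , isLattice , λ x y z x≤z → antisym
      (∨-least (∧-greatest (x≤x∨y x y) x≤z)
               (∧-greatest (≤ᴾ-trans (x∧y≤x y z) (y≤x∨y x y)) (x∧y≤y y z)))
      (≤ᴾ-trans (∧-greatest (x∧y≤y (x ∨ y) z) (x∧y≤x (x ∨ y) z))
        (≤ᴾ-trans (reflexive (∧-distribˡ-∨ z x y))
          (∨-least (≤ᴾ-trans (x∧y≤y z x) (x≤x∨y x (y ∧ z)))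
                   (≤ᴾ-trans (∧-greatest (x∧y≤y z y) (x∧y≤x z y)) (y≤x∨y x (y ∧ z))))))
    where
    open IsDistributiveLattice D
      using ( isLattice; ∧-distribˡ-∨; antisym; reflexive
            ; ∨-least; ∧-greatest; x≤x∨y; y≤x∨y; x∧y≤x; x∧y≤y )
      renaming (trans to ≤ᴾ-trans)

module _ (P : Pred (𝔖 n) 0ℓ) where

  private
    infix 4 _⊑_
    _⊑_ : Rel (∃ P) 0ℓ
    x ⊑ y = proj₁ x ≼ proj₁ y

  booleanIdeal⇒boolean : (c : ∃ P) → (∀ x → x ⊑ c) → ∀ {m} →
    BooleanIdeal _⊑_ c m → IsBoolean (Induced P)
  booleanIdeal⇒boolean c ≤c {m} ideal = m , φ , record
    { isOrderMonomorphism = record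
      { isOrderHomomorphism = record
        { cong = λ {x} {y} p → φ-cong x y (pointwise p)
        ; mono = λ {x} {y} p → mono (≤c x) (≤c y) (≤ᴮ⇒≼ p)
        }
      ; injective = λ {x} {y} p → at (≼-antisym
          (cancel (≤c x) (≤c y) (⊆ˢ-reflexive p)) (cancel (≤c y) (≤c x) (⊆ˢ-reflexive (sym p))))
      ; cancel = λ {x} {y} p → ≼⇒≤ᴮ (cancel (≤c x) (≤c y) p)
      }
    ; surjective = λ S → case preimage S of λ where
        (x , _ , eq) → x , λ {z} p → trans (φ-cong z x (pointwise p)) eq
    }
    where
    open BooleanIdeal ideal

    φ-cong : ∀ x y → proj₁ x ≃ proj₁ y → φ x ≡ φ y
    φ-cong x y p = ⊆-antisym (mono (≤c x) (≤c y) (≼-reflexive p))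
                             (mono (≤c y) (≤c x) (≼-reflexive (≃-sym p)))

Interval : (v w : 𝔖 n) → Set
Interval v w = ∃ λ u → v ≤ᴮ u × u ≤ᴮ w

module _ {v w : 𝔖 n} where

  lower-≼ : (x : Interval v w) → v ≼ proj₁ x
  lower-≼ (_ , l , _) = ≤ᴮ⇒≼ l

  upper-≼ : (x : Interval v w) → proj₁ x ≼ w
  upper-≼ (_ , _ , u) = ≤ᴮ⇒≼ u

  inside-interval : {u : 𝔖 n} → v ≼ u → u ≼ w → Interval v w
  inside-interval {u} l h = u , ≼⇒≤ᴮ l , ≼⇒≤ᴮ h

  private
    infix 4 _⊑_
    _⊑_ : Rel (Interval v w) 0ℓ
    x ⊑ y = proj₁ x ≼ proj₁ y

  module _ (v≼w : v ≼ w) where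

    bottom top : Interval v w
    bottom = inside-interval ≼-refl v≼w
    top    = inside-interval v≼w ≼-refl

    interval-boolean : ∀ {m} → BooleanIdeal _⊑_ top m → IsBoolean [ v , w ]
    interval-boolean = booleanIdeal⇒boolean _ top upper-≼

    modular⇒boolean : FormsModularLattice [ v , w ] → IsBoolean [ v , w ]
    modular⇒boolean (_∨_ , _∧_ , L , modular) = interval-boolean
      (ModularLattice.booleanIdeal L′ (λ x y z x⊑z → pointwise (modular x y z (≼⇒≤ᴮ x⊑z)))
        bottom lower-≼ (λ x y → proj₁ x ≼? proj₁ y) (λ x → len (proj₁ x))
        ≼⇒len≤ ≼∧len≥⇒≃ (λ {x} {y} → coatom′ {x} {y}) (λ {x} {y} → diamond′ {x} {y})
        (len w ∸ len v) {top} (sym (ℕ.m∸n+n≡m (≼⇒len≤ v≼w))))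
      where
      module L = IsLattice L

      L′ : IsLattice (λ x y → proj₁ x ≃ proj₁ y) _⊑_ _∨_ _∧_
      L′ = record
        { isPartialOrder = record
          { isPreorder = record
            { isEquivalence = record { refl = ≃-refl ; sym = ≃-sym ; trans = ≃-trans }
            ; reflexive = ≼-reflexive
            ; trans     = ≼-trans
            }
          ; antisym = ≼-antisym
          }
        ; supremum = λ x y → case L.supremum x y of λ where
            (p , q , least) → ≤ᴮ⇒≼ p , ≤ᴮ⇒≼ q , λ z a b → ≤ᴮ⇒≼ (least z (≼⇒≤ᴮ a) (≼⇒≤ᴮ b))
        ; infimum = λ x y → case L.infimum x y of λ where
            (p , q , greatest) → ≤ᴮ⇒≼ p , ≤ᴮ⇒≼ q , λ z a b → ≤ᴮ⇒≼ (greatest z (≼⇒≤ᴮ a) (≼⇒≤ᴮ b))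
        }

      coatom′ : ∀ {x y : Interval v w} → x ⊑ y → len (proj₁ x) < len (proj₁ y) →
        ∃ λ d → x ⊑ d × d ⊑ y × len (proj₁ y) ≡ suc (len (proj₁ d))
      coatom′ {x} {y} x⊑y lt = case coatom x⊑y lt of λ where
        (d , x≼d , d≼y , e) →
          inside-interval (≼-trans (lower-≼ x) x≼d) (≼-trans d≼y (upper-≼ y)) , x≼d , d≼y , e

      diamond′ : ∀ {x y : Interval v w} → x ⊑ y → len (proj₁ y) ≡ 2 + len (proj₁ x) →
        Ranked.Diamond (λ x y → proj₁ x ≃ proj₁ y) _⊑_ (λ x → len (proj₁ x)) x y
      diamond′ {x} {y} x⊑y e = restrict (diamond x⊑y e)
        where
        restrict : Diamond (proj₁ x) (proj₁ y) →
          Ranked.Diamond (λ x y → proj₁ x ≃ proj₁ y) _⊑_ (λ x → len (proj₁ x)) x y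
        restrict d = record
          { left          = embed left-between
          ; right         = embed right-between
          ; left-between  = Ranked.between (lower left-between) (upper left-between) (rank-suc left-between)
          ; right-between = Ranked.between (lower right-between) (upper right-between) (rank-suc right-between)
          ; distinct      = distinct
          ; exhaustive    = λ z (Ranked.between l h r) → exhaustive (proj₁ z) (between l h r)
          }
          where
          open Diamond d
          open Between
          embed : ∀ {z} → Between (proj₁ x) (proj₁ y) z → Interval v w
          embed (between l h _) = inside-interval (≼-trans (lower-≼ x) l) (≼-trans h (upper-≼ y))

    -- Serves the braid, of length three. The four elements are told apart by which of the two
    -- intermediate ones lie below them.
    rank-two⇒boolean : len w ≡ 2 + len v → IsBoolean [ v , w ]
    rank-two⇒boolean e = interval-boolean record
      { φ        = λ x → pair (left ≼? proj₁ x) (right ≼? proj₁ x)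
      ; mono     = λ {x} {y} _ _ x≼y → pair-mono (left ≼? proj₁ x) (right ≼? proj₁ x)
                     (left ≼? proj₁ y) (right ≼? proj₁ y) (λ l → ≼-trans l x≼y) (λ r → ≼-trans r x≼y)
      ; cancel   = λ {x} {y} _ _ s →
          let ll , rr = pair-cancel (left ≼? proj₁ x) (right ≼? proj₁ x) (left ≼? proj₁ y) (right ≼? proj₁ y) s
          in below-by-atoms (classify (lower-≼ x) (upper-≼ x)) (lower-≼ y) (upper-≼ y) (upper-≼ x) ll rr
      ; preimage = λ where
          (outside ∷ outside ∷ []) → bottom , v≼w , cong₂ (λ a b → a ∷ b ∷ [])
            (dec-false (left ≼? v) (left⋠ ≼-refl)) (dec-false (right ≼? v) (right⋠ ≼-refl))
          (inside ∷ outside ∷ []) → atom left-between , upper left-between , cong₂ (λ a b → a ∷ b ∷ [])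
            (dec-true (left ≼? left) ≼-refl) (dec-false (right ≼? left) right⋠left)
          (outside ∷ inside ∷ []) → atom right-between , upper right-between , cong₂ (λ a b → a ∷ b ∷ [])
            (dec-false (left ≼? right) left⋠right) (dec-true (right ≼? right) ≼-refl)
          (inside ∷ inside ∷ []) → top , ≼-refl , cong₂ (λ a b → a ∷ b ∷ [])
            (dec-true (left ≼? w) (upper left-between)) (dec-true (right ≼? w) (upper right-between))
      }
      where
      open Diamond (diamond v≼w e)
      open Between

      atom : ∀ {z} → Between v w z → Interval v w
      atom (between l h _) = inside-interval l h

      same-rank : len left ≡ len right
      same-rank = trans (rank-suc left-between) (sym (rank-suc right-between))

      left⋠right : ¬ left ≼ right
      left⋠right p = distinct (≼∧len≥⇒≃ p (ℕ.≤-reflexive (sym same-rank)))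

      right⋠left : ¬ right ≼ left
      right⋠left p = distinct (≃-sym (≼∧len≥⇒≃ p (ℕ.≤-reflexive same-rank)))

      left⋠ : ∀ {y} → y ≼ v → ¬ left ≼ y
      left⋠ y≼v p = <-irrefl refl (subst (_≤ len v) (rank-suc left-between) (≼⇒len≤ (≼-trans p y≼v)))

      right⋠ : ∀ {y} → y ≼ v → ¬ right ≼ y
      right⋠ y≼v p = <-irrefl refl (subst (_≤ len v) (rank-suc right-between) (≼⇒len≤ (≼-trans p y≼v)))

      data Position (x : 𝔖 n) : Set where
        is-bottom : x ≼ v → Position x
        is-left   : x ≃ left → Position x
        is-right  : x ≃ right → Position x
        is-top    : w ≼ x → Position x

      classify : ∀ {x} → v ≼ x → x ≼ w → Position x
      classify {x} v≼x x≼w with len x ℕ.≤? len v | len w ℕ.≤? len x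
      ... | yes p | _     = is-bottom (≼-reflexive (≃-sym (≼∧len≥⇒≃ v≼x p)))
      ... | no _  | yes q = is-top (≼-reflexive (≃-sym (≼∧len≥⇒≃ x≼w q)))
      ... | no p  | no q  = case exhaustive x (between v≼x x≼w
            (ℕ.≤-antisym (ℕ.≤-pred (subst (len x <_) e (ℕ.≰⇒> q))) (ℕ.≰⇒> p))) of λ where
          (inj₁ l) → is-left l
          (inj₂ r) → is-right r

      below-by-atoms : ∀ {x y} → Position x → v ≼ y → y ≼ w → x ≼ w →
        (left ≼ x → left ≼ y) → (right ≼ x → right ≼ y) → x ≼ y
      below-by-atoms (is-bottom x≼v) v≼y _ _ _ _ = ≼-trans x≼v v≼y
      below-by-atoms (is-left p) _ _ _ ll _ = ≼-trans (≼-reflexive p) (ll (≼-reflexive (≃-sym p)))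
      below-by-atoms (is-right p) _ _ _ _ rr = ≼-trans (≼-reflexive p) (rr (≼-reflexive (≃-sym p)))
      below-by-atoms {x} {y} (is-top w≼x) v≼y y≼w x≼w ll rr = ≼-trans x≼w (go (classify v≼y y≼w))
        where
        l≼y : left ≼ y
        l≼y = ll (≼-trans (upper left-between) w≼x)
        r≼y : right ≼ y
        r≼y = rr (≼-trans (upper right-between) w≼x)
        go : Position y → w ≼ y
        go (is-bottom y≼v) = contradiction l≼y (left⋠ y≼v)
        go (is-left p)     = contradiction (≼-trans r≼y (≼-reflexive p)) right⋠left
        go (is-right p)    = contradiction (≼-trans l≼y (≼-reflexive p)) left⋠right
        go (is-top w≼y)    = w≼y

      pair : {A B : Set} → Dec A → Dec B → Subset 2
      pair a b = does a ∷ does b ∷ []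

      pair-mono : {A B C D : Set} (a : Dec A) (b : Dec B) (c : Dec C) (d : Dec D) →
        (A → C) → (B → D) → pair a b ⊆ˢ pair c d
      pair-mono (yes a) _ (no ¬c) _ f _ = contradiction (f a) ¬c
      pair-mono _ (yes b) _ (no ¬d) _ g = contradiction (g b) ¬d
      pair-mono (no _) (no _) _ _ _ _ = out⊆ (out⊆ λ ())
      pair-mono (no _) (yes _) _ (yes _) _ _ = out⊆ (s⊆s λ ())
      pair-mono (yes _) (no _) (yes _) _ _ _ = s⊆s (out⊆ λ ())
      pair-mono (yes _) (yes _) (yes _) (yes _) _ _ = s⊆s (s⊆s λ ())

      pair-cancel : {A B C D : Set} (a : Dec A) (b : Dec B) (c : Dec C) (d : Dec D) →
        pair a b ⊆ˢ pair c d → (A → C) × (B → D)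
      pair-cancel a b c d s =
        head a c s , head b d (drop-∷-⊆ s)
        where
        head : {A C : Set} {m : ℕ} {p q : Subset m} (a : Dec A) (c : Dec C) →
          does a ∷ p ⊆ˢ does c ∷ q → A → C
        head _        (yes c) _ _ = c
        head (yes _)  (no _)  s _ = case s {zero} here of λ ()
        head (no ¬a)  (no _)  _ a = contradiction a ¬a

induced-isPartialOrder : (P : Pred (𝔖 n) 0ℓ) →
  IsPartialOrder (RawRelation._≈_ (Induced P)) (RawRelation._∼_ (Induced P))
induced-isPartialOrder P = record
  { isPreorder = record
    { isEquivalence = record
      { refl  = λ _ → refl
      ; sym   = λ p x → sym (p x)
      ; trans = λ p q x → trans (p x) (q x)
      }
    ; reflexive = λ {x} {y} p → ≼⇒≤ᴮ (≼-reflexive (pointwise {v = proj₁ x} {proj₁ y} p))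
    ; trans     = λ {x} {y} {z} p q → ≼⇒≤ᴮ {u = proj₁ x} {proj₁ z}
        (≼-trans (≤ᴮ⇒≼ {w = proj₁ y} p) (≤ᴮ⇒≼ q))
    }
  ; antisym = λ {x} {y} p q → at (≼-antisym (≤ᴮ⇒≼ {u = proj₁ x} {proj₁ y} p) (≤ᴮ⇒≼ q))
  }

modular-upper-interval : {v w : 𝔖 n} → v ≼ w →
  FormsModularLattice (↓ w) → FormsModularLattice [ v , w ]
modular-upper-interval {n} {v} {w} v≼w (_∨_ , _∧_ , L , modular) = _∨′_ , _∧′_ , record
    { isPartialOrder = induced-isPartialOrder _
    ; supremum = λ x y → x≤x∨y (forget x) (forget y) , y≤x∨y (forget x) (forget y) ,
        λ z → ∨-least {forget x} {forget y} {forget z}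
    ; infimum = λ x y → x∧y≤x (forget x) (forget y) , x∧y≤y (forget x) (forget y) ,
        λ z → ∧-greatest {forget z} {forget x} {forget y}
    } , λ x y z → modular (forget x) (forget y) (forget z)
  where
  open IsLattice L using (x≤x∨y; y≤x∨y; ∨-least; x∧y≤x; x∧y≤y; ∧-greatest)

  forget : Interval v w → ∃ λ u → u ≤ᴮ w
  forget (u , _ , u≤w) = u , u≤w

  v′ : ∃ λ u → u ≤ᴮ w
  v′ = v , ≼⇒≤ᴮ v≼w

  _∨′_ _∧′_ : Interval v w → Interval v w → Interval v w
  x ∨′ y = proj₁ (forget x ∨ forget y) ,
    ≼⇒≤ᴮ (≼-trans (lower-≼ {v = v} {w} x)
      (≤ᴮ⇒≼ {w = proj₁ (forget x ∨ forget y)} (x≤x∨y (forget x) (forget y)))) ,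
    proj₂ (forget x ∨ forget y)
  x ∧′ y = proj₁ (forget x ∧ forget y) ,
    ∧-greatest {v′} {forget x} {forget y} (proj₁ (proj₂ x)) (proj₁ (proj₂ y)) ,
    proj₂ (forget x ∧ forget y)

distinct⇒boolean : {t : Word n} {w : 𝔖 n} → Unique t → ⟦ t ⟧ ≃ w → IsBoolean (↓ w)
distinct⇒boolean {t = t} {w} u p = booleanIdeal⇒boolean _ (w , ≼⇒≤ᴮ (≼-refl {w = w}))
  (λ x → ≤ᴮ⇒≼ {u = proj₁ x} (proj₂ x)) record
  { φ        = λ x → φ (proj₁ x)
  ; mono     = λ x y → mono (≼-trans x ≼t) (≼-trans y ≼t)
  ; cancel   = λ x y → cancel (≼-trans x ≼t) (≼-trans y ≼t)
  ; preimage = λ S → case preimage S of λ where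
      (x , x≼t , eq) → (x , ≼⇒≤ᴮ (≼-trans x≼t (≼-reflexive p))) , ≼-trans x≼t (≼-reflexive p) , eq
  }
  where
  open BooleanIdeal (distinct⇒BooleanIdeal u)
  ≼t : w ≼ ⟦ t ⟧
  ≼t = ≼-reflexive (≃-sym p)

-- Atoms of a boolean interval

⊈-witness : {m : ℕ} (p q : Subset m) → ¬ p ⊆ˢ q → ∃ λ x → x ∈ˢ p × x ∉ˢ q
⊈-witness p q p⊈q with any? (λ x → x ∈ˢ? p ×-dec ¬? (x ∈ˢ? q))
... | yes found = found
... | no none   = contradiction
  (λ {x} x∈p → decidable-stable (x ∈ˢ? q) λ x∉q → none (x , x∈p , x∉q)) p⊈q

⋠⇒len< : {x y : 𝔖 n} → x ≼ y → ¬ y ≼ x → len x < len y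
⋠⇒len< x≼y y⋠x = ℕ.≰⇒> λ r → y⋠x (≼-reflexive (≃-sym (≼∧len≥⇒≃ x≼y r)))

private
  -- `coatom` only removes one unit of length at the top; it is repeated until just one unit above
  -- `v` is left.
  atom-below-≤ : (k : ℕ) {v u : 𝔖 n} → len u ≤ k → v ≼ u → len v < len u →
    ∃ λ a → v ≼ a × a ≼ u × len a ≡ suc (len v)
  atom-below-≤ zero    u≤k _ lt = contradiction (≤-trans lt u≤k) λ ()
  atom-below-≤ (suc k) {v} u≤k v≼u lt = case coatom v≼u lt of λ where
    (d , v≼d , d≼u , e) → case len v ℕ.<? len d of λ where
      (yes v<d) → case atom-below-≤ k (ℕ.≤-pred (subst (_≤ suc k) e u≤k)) v≼d v<d of λ where
        (a , v≼a , a≼d , ea) → a , v≼a , ≼-trans a≼d d≼u , ea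
      (no v≮d) → _ , v≼u , ≼-refl ,
        trans e (cong suc (ℕ.≤-antisym (ℕ.≮⇒≥ v≮d) (≼⇒len≤ v≼d)))

atom-below : {v u : 𝔖 n} → v ≼ u → len v < len u → ∃ λ a → v ≼ a × a ≼ u × len a ≡ suc (len v)
atom-below = atom-below-≤ _ ≤-refl

record NewAtom (v u u′ a : 𝔖 n) : Set where
  constructor newAtom
  field
    above : v ≼ a
    rank  : len a ≡ suc (len v)
    reached : a ≼ u′
    new   : ¬ a ≼ u

module BooleanInterval {v w : 𝔖 n} (boolean : IsBoolean [ v , w ]) where

  private
    m : ℕ
    m = proj₁ boolean

    f : Interval v w → Subset m
    f = proj₁ (proj₂ boolean)

    open IsOrderIsomorphism (proj₂ (proj₂ boolean)) using (surjective; mono; cancel)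

    f-mono : ∀ x y → proj₁ x ≼ proj₁ y → f x ⊆ˢ f y
    f-mono x y p = mono {x} {y} (≼⇒≤ᴮ p)

    f-cancel : ∀ x y → f x ⊆ˢ f y → proj₁ x ≼ proj₁ y
    f-cancel x y p = ≤ᴮ⇒≼ (cancel {x} {y} p)

    g : Subset m → Interval v w
    g S = proj₁ (surjective S)

    f-g : ∀ S → f (g S) ≡ S
    f-g S = proj₂ (surjective S) {g S} (λ _ → refl)

    g-mono : ∀ S x → S ⊆ˢ f x → proj₁ (g S) ≼ proj₁ x
    g-mono S x p = f-cancel (g S) x (⊆ˢ-trans (⊆ˢ-reflexive (f-g S)) p)

    g-∈ : ∀ S x {z} → z ∈ˢ S → proj₁ (g S) ≼ proj₁ x → z ∈ˢ f x
    g-∈ S x z∈S p = f-mono (g S) x p (subst (_ ∈ˢ_) (sym (f-g S)) z∈S)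

    separate : ∀ x y → ¬ proj₁ x ≼ proj₁ y → ∃ λ z → z ∈ˢ f x × z ∉ˢ f y
    separate x y x⋠y = ⊈-witness (f x) (f y) (x⋠y ∘ f-cancel x y)

    ⁅⁆⊆ : ∀ {z} {S : Subset m} → z ∈ˢ S → ⁅ z ⁆ ⊆ˢ S
    ⁅⁆⊆ {z} {S} z∈S e = subst (_∈ˢ S) (sym (x∈⁅y⁆⇒x≡y z e)) z∈S

  -- Some `z` lies in the image of `u′` but not of `u`. The preimage `c` of its singleton is above
  -- an atom `a`, chosen by length; the image of `a` is a nonempty subset of that singleton, so
  -- `a ≼ u` would put `z` into the image of `u`.
  new-atom : {u u′ : 𝔖 n} → v ≼ u → u ≼ w → v ≼ u′ → u′ ≼ w → ¬ u′ ≼ u →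
    ∃ λ a → NewAtom v u u′ a
  new-atom {u} {u′} v≼u u≼w v≼u′ u′≼w u′⋠u = go (separate U′ U u′⋠u)
    where
    U U′ V : Interval v w
    U  = inside-interval v≼u u≼w
    U′ = inside-interval v≼u′ u′≼w
    V  = inside-interval ≼-refl (≼-trans v≼u u≼w)

    go : (∃ λ z → z ∈ˢ f U′ × z ∉ˢ f U) → ∃ λ a → NewAtom v u u′ a
    go (z , z∈U′ , z∉U) = finish (g ⁅ z ⁆) (g-mono ⁅ z ⁆ U′ (⁅⁆⊆ z∈U′))
        (λ x → g-∈ ⁅ z ⁆ x (x∈⁅x⁆ z)) (⊆ˢ-reflexive (f-g ⁅ z ⁆))
      where
      finish : (c : Interval v w) → proj₁ c ≼ u′ → (∀ x → proj₁ c ≼ proj₁ x → z ∈ˢ f x) →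
        f c ⊆ˢ ⁅ z ⁆ → ∃ λ a → NewAtom v u u′ a
      finish c c≼u′ z∈ c⊆ = case atom-below (lower-≼ {v = v} {w} c) (⋠⇒len< (lower-≼ {v = v} {w} c)
                                  (λ c≼v → z∉U (z∈ U (≼-trans c≼v v≼u)))) of λ where
        (a , v≼a , a≼c , e) →
          let A = inside-interval v≼a (≼-trans a≼c (upper-≼ {v = v} {w} c)) in
          a , newAtom v≼a e (≼-trans a≼c c≼u′)
            (λ a≼u → case separate A V (λ a≼v → <-irrefl refl (subst (_≤ len v) e (≼⇒len≤ a≼v))) of λ where
              (y , y∈A , _) → z∉U (subst (_∈ˢ f U) (x∈⁅y⁆⇒x≡y z (c⊆ (f-mono A c a≼c y∈A)))
                                 (f-mono A U a≼u y∈A)))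

  -- Let `z` and `z′` be elements that `a` and `b` have and `u` lacks. If they differed, adding only
  -- `z` to the image of `u` would give an element strictly between `u` and `u′`. So the preimage of
  -- one singleton lies below both atoms, and by length equals both.
  new-atom-unique : {u u′ a b : 𝔖 n} → v ≼ u → u ≼ u′ → u′ ≼ w → len u′ ≡ suc (len u) →
    NewAtom v u u′ a → NewAtom v u u′ b → a ≃ b
  new-atom-unique {u} {u′} {a} {b} v≼u u≼u′ u′≼w e
    (newAtom v≼a ea a≼u′ a⋠u) (newAtom v≼b eb b≼u′ b⋠u) = go (separate A U a⋠u) (separate B U b⋠u)
    where
    U U′ A B V : Interval v w
    U  = inside-interval v≼u (≼-trans u≼u′ u′≼w)
    U′ = inside-interval (≼-trans v≼u u≼u′) u′≼w
    A  = inside-interval v≼a (≼-trans a≼u′ u′≼w)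
    B  = inside-interval v≼b (≼-trans b≼u′ u′≼w)
    V  = inside-interval ≼-refl (≼-trans v≼u (≼-trans u≼u′ u′≼w))

    module _ {z z′ : Fin m} (z∈A : z ∈ˢ f A) (z∉U : z ∉ˢ f U) (z′∈B : z′ ∈ˢ f B) (z′∉U : z′ ∉ˢ f U) where

      same : z ≡ z′
      same with z ≟ z′
      ... | yes p = p
      ... | no z≢z′ = ⊥-elim (<-irrefl refl (≤-trans (s≤s u<c) (subst (suc (len (proj₁ c)) ≤_) e c<u′)))
        where
        S : Subset m
        S = f U ∪ ⁅ z ⁆

        c : Interval v w
        c = g S

        u≼c : u ≼ proj₁ c
        u≼c = f-cancel U c (⊆ˢ-trans (p⊆p∪q ⁅ z ⁆) (⊆ˢ-reflexive (sym (f-g S))))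

        c≼u′ : proj₁ c ≼ u′
        c≼u′ = g-mono S U′ λ y∈ → case x∈p∪q⁻ (f U) ⁅ z ⁆ y∈ of λ where
          (inj₁ y∈U) → f-mono U U′ u≼u′ y∈U
          (inj₂ y∈z) → ⁅⁆⊆ (f-mono A U′ a≼u′ z∈A) y∈z

        u<c : len u < len (proj₁ c)
        u<c = ⋠⇒len< u≼c λ c≼u → z∉U (g-∈ S U (q⊆p∪q (f U) ⁅ z ⁆ (x∈⁅x⁆ z)) c≼u)

        c<u′ : len (proj₁ c) < len u′
        c<u′ = ⋠⇒len< c≼u′ λ u′≼c →
          case x∈p∪q⁻ (f U) ⁅ z ⁆ (subst (z′ ∈ˢ_) (f-g S) (f-mono B c (≼-trans b≼u′ u′≼c) z′∈B)) of λ where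
            (inj₁ z′∈U) → z′∉U z′∈U
            (inj₂ z′∈z) → z≢z′ (sym (x∈⁅y⁆⇒x≡y z z′∈z))

    go : (∃ λ z → z ∈ˢ f A × z ∉ˢ f U) → (∃ λ z → z ∈ˢ f B × z ∉ˢ f U) → a ≃ b
    go (z , z∈A , z∉U) (z′ , z′∈B , z′∉U) = finish (g ⁅ z ⁆) (g-mono ⁅ z ⁆ A (⁅⁆⊆ z∈A))
        (g-mono ⁅ z ⁆ B (⁅⁆⊆ (subst (_∈ˢ f B) (sym (same z∈A z∉U z′∈B z′∉U)) z′∈B)))
        (λ c≼v → z∉U (f-mono V U v≼u (g-∈ ⁅ z ⁆ V (x∈⁅x⁆ z) c≼v)))
      where
      finish : (c : Interval v w) → proj₁ c ≼ a → proj₁ c ≼ b → ¬ proj₁ c ≼ v → a ≃ b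
      finish c c≼a c≼b c⋠v = ≃-trans (≃-sym (equal ea c≼a)) (equal eb c≼b)
        where
        equal : ∀ {d} → len d ≡ suc (len v) → proj₁ c ≼ d → proj₁ c ≃ d
        equal ed c≼d = ≼∧len≥⇒≃ c≼d (subst (_≤ len (proj₁ c)) (sym ed) (⋠⇒len< (lower-≼ {v = v} {w} c) c⋠v))

-- Boolean principal ideals

id≼ : (w : 𝔖 n) → ⟦ [] ⟧ ≼ w
id≼ w = case reducedWord w of λ where
  (t , rt , pt) → Below⇒≼ rt pt ([] , minimum t , ≃-refl)

⊆⇒≼ : {s t : Word n} {w : 𝔖 n} → Reduced t → ⟦ t ⟧ ≃ w → s ⊆ t → ⟦ s ⟧ ≼ w
⊆⇒≼ rt pt s⊆t = Below⇒≼ rt pt (_ , s⊆t , ≃-refl)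

≼⇒reducedSubword : {t : Word n} {u : 𝔖 n} → Reduced t → u ≼ ⟦ t ⟧ →
  ∃ λ s → s ⊆ t × Reduced s × ⟦ s ⟧ ≃ u
≼⇒reducedSubword rt u≼t = case below u≼t rt ≃-refl of λ where
  (s , s⊆t , p) → case reduce s of λ where
    (s′ , s′⊆s , rs′ , q) → s′ , ⊆-trans s′⊆s s⊆t , rs′ , ≃-trans q p

length<⇒⋠ : {s t : Word n} → Reduced s → Reduced t → length s < length t → ¬ ⟦ t ⟧ ≼ ⟦ s ⟧
length<⇒⋠ rs rt lt p =
  <-irrefl refl (≤-trans lt (subst₂ _≤_ (len-⟦⟧ rt) (len-⟦⟧ rs) (≼⇒len≤ p)))

boolean-↓⇒boolean : {v w : 𝔖 n} → v ≼ w → IsBoolean (↓ w) → IsBoolean [ v , w ]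
boolean-↓⇒boolean {w = w} v≼w B =
  modular⇒boolean v≼w (modular-upper-interval v≼w
    (distributive⇒modular (↓ w) (boolean⇒distributive (↓ w) B)))

-- The new atom between ⟦ x ⟧ and ⟦ i ∷ x ⟧ can only be σ i, so i does not occur in x.
boolean-↓⇒Unique : {w : 𝔖 n} → IsBoolean (↓ w) → (s : Word n) → Reduced s → ⟦ s ⟧ ≼ w → Unique s
boolean-↓⇒Unique B [] _ _ = []
boolean-↓⇒Unique {n} {w} B (i ∷ x) r ix≼w =
  All.¬Any⇒All¬ x i∉x ∷ boolean-↓⇒Unique B x (Reduced-tail r) x≼w
  where
  x≼ix : ⟦ x ⟧ ≼ ⟦ i ∷ x ⟧
  x≼ix = ⊆⇒≼ r ≃-refl (i ∷ʳ ⊆-refl)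

  x≼w : ⟦ x ⟧ ≼ w
  x≼w = ≼-trans x≼ix ix≼w

  i∉x : i ∉ˡ x
  i∉x i∈x = case new-atom (id≼ ⟦ x ⟧) x≼w (id≼ ⟦ i ∷ x ⟧) ix≼w (length<⇒⋠ (Reduced-tail r) r ≤-refl) of λ where
      (a , newAtom _ rank reached new) → case ≼⇒reducedSubword r reached of λ where
        (s , s⊆ , rs , p) → absurd s⊆ (trans (sym (Reduced⇒len rs p)) (trans rank (cong suc (len-⟦⟧ Reduced-[]))))
          λ s⊆x → new (≼-trans (≼-reflexive (≃-sym p)) (⊆⇒≼ (Reduced-tail r) ≃-refl s⊆x))
    where
    open BooleanInterval (boolean-↓⇒boolean (id≼ w) B)
    absurd : ∀ {s} → s ⊆ i ∷ x → length s ≡ 1 → ¬ ¬ s ⊆ x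
    absurd (_ ∷ʳ s⊆x) _ k = k s⊆x
    absurd {_ ∷ []} (refl ∷ _) _ k = k (from∈ i∈x)

support⇒σ≼ : {w : 𝔖 n} {i : Fin n} → support w i → σ i ≼ w
support⇒σ≼ {w = w} (s , isRed , i∈s) = case IsReduced⇒Reduced {w = w} s isRed of λ where
  (rs , ps) → ∈⇒σ≼ rs ps i∈s

-- Repeated letters

data Repetition {n : ℕ} : Word n → Set where
  repetition : (a : Word n) (i : Fin n) (p b : Word n) → i ∉ˡ p → Unique p →
    Repetition (a ++ i ∷ p ++ i ∷ b)

private
  first-occurrence : {i : Fin n} {t : Word n} → Unique t → i ∈ˡ t →
    ∃₂ λ p b → t ≡ p ++ i ∷ b × i ∉ˡ p × Unique p
  first-occurrence _ (here refl) = [] , _ , refl , (λ ()) , []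
  first-occurrence {t = x ∷ t} un@(x≢ ∷ uniq) (there i∈t) = case first-occurrence uniq i∈t of λ where
    (p , b , refl , i∉p , p-uniq) → x ∷ p , b , refl ,
      (λ { (here refl) → Unique⇒∉ un i∈t ; (there i∈p) → i∉p i∈p }) , All.++⁻ˡ p x≢ ∷ p-uniq

-- Read from the right: at the first letter that recurs, the tail is still free of repetitions,
-- hence so is the factor `p` enclosed by the two occurrences.
unique-or-repetition : (t : Word n) → Unique t ⊎ Repetition t
unique-or-repetition [] = inj₁ []
unique-or-repetition (i ∷ t) = case unique-or-repetition t of λ where
  (inj₂ (repetition a j p b j∉p uniq)) → inj₂ (repetition (i ∷ a) j p b j∉p uniq)
  (inj₁ uniq) → case i ∈? t of λ where
    (no i∉t)  → inj₁ (All.¬Any⇒All¬ t i∉t ∷ uniq)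
    (yes i∈t) → case first-occurrence uniq i∈t of λ where
      (p , b , refl , i∉p , p-uniq) → inj₂ (repetition [] i p b i∉p p-uniq)

¬Reduced-square : {i : Fin n} {s : Word n} → ¬ Reduced (i ∷ i ∷ s)
¬Reduced-square r = Reduced⇒¬Descent r (Reduced⇒Descent (Reduced-tail r))

σ-injective : {i j : Fin n} → ⟦ i ∷ [] ⟧ ≃ ⟦ j ∷ [] ⟧ → i ≡ j
σ-injective {i = i} {j} p =
  case Descent⇒∈ (j ∷ []) (Descent-resp {v = ⟦ i ∷ [] ⟧} p (Reduced⇒Descent Reduced-[ i ])) of λ { (here e) → e }

Reduced-pair : {i j : Fin n} → i ≢ j → Reduced (i ∷ j ∷ [])
Reduced-pair {j = j} i≢j = Reduced-∷ Reduced-[ j ] (∉⇒¬Descent (j ∷ []) λ { (here e) → i≢j e })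

-- Were `l` a descent of `⟦ k ∷ l ∷ [] ⟧`, as `k` is, then `Descent-2` would give the identity a
-- descent.
braid-Reduced : {k l : Fin n} → Adjacent k l → k ≢ l → Reduced (l ∷ k ∷ l ∷ [])
braid-Reduced {k = k} {l} adj k≢l = Reduced-∷ r λ d → ∉⇒¬Descent [] (λ ())
    (Descent-resp {v = σ l · (σ k · ⟦ k ∷ l ∷ [] ⟧)} {⟦ [] ⟧}
      (≃-trans (·-congˡ (σ l) (σ-involutive k {⟦ l ∷ [] ⟧})) (σ-involutive l {⟦ [] ⟧}))
      (Descent-2 adj {⟦ k ∷ l ∷ [] ⟧} (Reduced⇒Descent r) d))
  where
  r : Reduced (k ∷ l ∷ [])
  r = Reduced-pair k≢l

module BooleanAbove {w : 𝔖 n} {t : Word n} (rt : Reduced t) (pt : ⟦ t ⟧ ≃ w)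
  (boolean : ∀ {i} → i ∈ˡ t → IsBoolean [ σ i , w ]) where

  -- Atoms of the interval above `σ j` have length two, so the new atom is read as a two-letter
  -- subword of `y` in which `j` occurs.
  new-pair : {j : Fin n} {x y : Word n} → j ∈ˡ x → x ⊆ y → y ⊆ t → Reduced x → Reduced y →
    length x < length y →
    ∃₂ λ c d → c ∷ d ∷ [] ⊆ y × Reduced (c ∷ d ∷ []) × j ∈ˡ c ∷ d ∷ [] × ¬ ⟦ c ∷ d ∷ [] ⟧ ≼ ⟦ x ⟧
  new-pair {j} {x} {y} j∈x x⊆y y⊆t rx ry lt =
    case BooleanInterval.new-atom (boolean (lookup (⊆-trans x⊆y y⊆t) j∈x))
           (∈⇒σ≼ rx ≃-refl j∈x) (⊆⇒≼ rt pt (⊆-trans x⊆y y⊆t))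
           (∈⇒σ≼ ry ≃-refl (lookup x⊆y j∈x)) (⊆⇒≼ rt pt y⊆t) (length<⇒⋠ rx ry lt) of λ where
      (a , newAtom above rank reached new) → case ≼⇒reducedSubword ry reached of λ where
        (s , s⊆y , rs , p) → pair-of s s⊆y rs (σ≼⇒∈ rs p above)
          (trans (sym (Reduced⇒len rs p)) (trans rank (cong suc (len-σ j))))
          (λ s≼x → new (≼-trans (≼-reflexive (≃-sym p)) s≼x))
    where
    pair-of : ∀ s → s ⊆ y → Reduced s → j ∈ˡ s → length s ≡ 2 → ¬ ⟦ s ⟧ ≼ ⟦ x ⟧ →
      ∃₂ λ c d → c ∷ d ∷ [] ⊆ y × Reduced (c ∷ d ∷ []) × j ∈ˡ c ∷ d ∷ [] × ¬ ⟦ c ∷ d ∷ [] ⟧ ≼ ⟦ x ⟧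
    pair-of (c ∷ d ∷ []) s⊆y rs j∈s _ s⋠x = c , d , s⊆y , rs , j∈s , s⋠x

  -- A pair avoiding the first letter would be a subword of `x`. So the new pair starts with `i`,
  -- and its other letter must be `j`.
  new-pair-∷ : {i j : Fin n} {x : Word n} → j ∈ˡ x → j ≢ i → i ∷ x ⊆ t → Reduced (i ∷ x) →
    ¬ ⟦ i ∷ j ∷ [] ⟧ ≼ ⟦ x ⟧
  new-pair-∷ {i} {j} {x} j∈x j≢i ix⊆t r =
    case new-pair j∈x (i ∷ʳ ⊆-refl) ix⊆t (Reduced-tail r) r ≤-refl of λ where
      (_ , _ , _ ∷ʳ s⊆x , _ , _ , s⋠x) → contradiction (⊆⇒≼ (Reduced-tail r) ≃-refl s⊆x) s⋠x
      (_ , _ , refl ∷ _ , _ , here j≡i , _) → contradiction j≡i j≢i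
      (_ , _ , refl ∷ _ , _ , there (here refl) , s⋠x) → s⋠x

  module _ {i : Fin n} {p : Word n} (i∉p : i ∉ˡ p) (p-unique : Unique p)
    (ipi⊆t : i ∷ p ++ i ∷ [] ⊆ t) (r : Reduced (i ∷ p ++ i ∷ [])) where

    private
      ∈p⇒≢ : ∀ {m} → m ∈ˡ p → m ≢ i
      ∈p⇒≢ m∈p refl = i∉p m∈p

      fresh : ∀ {m} → m ∈ˡ p → NewAtom (σ i) ⟦ p ++ i ∷ [] ⟧ ⟦ i ∷ p ++ i ∷ [] ⟧ ⟦ i ∷ m ∷ [] ⟧
      fresh {m} m∈p = newAtom (∈⇒σ≼ rim ≃-refl (here refl))
          (trans (len-⟦⟧ rim) (cong suc (sym (len-σ i))))
          (⊆⇒≼ r ≃-refl (refl ∷ from∈ (∈-++⁺ˡ m∈p)))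
          (new-pair-∷ (∈-++⁺ˡ m∈p) (∈p⇒≢ m∈p) ipi⊆t r)
        where
        rim : Reduced (i ∷ m ∷ [])
        rim = Reduced-pair (∈p⇒≢ m∈p ∘ sym)

    same-letter : ∀ {m m′} → m ∈ˡ p → m′ ∈ˡ p → m ≡ m′
    same-letter m∈p m′∈p = σ-injective (σ-cancel i
      (BooleanInterval.new-atom-unique (boolean (lookup ipi⊆t (here refl)))
        (∈⇒σ≼ (Reduced-tail r) ≃-refl (∈-++⁺ʳ p (here refl)))
        (⊆⇒≼ r ≃-refl (i ∷ʳ ⊆-refl)) (⊆⇒≼ rt pt ipi⊆t)
        (trans (len-⟦⟧ r) (cong suc (sym (len-⟦⟧ (Reduced-tail r)))))
        (fresh m∈p) (fresh m′∈p)))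

    singleton : ∃ λ m → p ≡ m ∷ []
    singleton = go p refl
      where
      go : ∀ q → p ≡ q → ∃ λ m → p ≡ m ∷ []
      go []           refl = contradiction r ¬Reduced-square
      go (m ∷ [])     refl = m , refl
      go (m ∷ m′ ∷ q) refl = contradiction (same-letter (here refl) (there (here refl)))
        (λ { refl → Unique⇒∉ p-unique (here refl) })

  module _ {i m : Fin n} (i≢m : i ≢ m) where

    -- If the letters commuted, the pair `i m` would equal `m i`, the word left after removing the
    -- first `i`, and would not be new.
    adjacent-letters : i ∷ m ∷ i ∷ [] ⊆ t → Reduced (i ∷ m ∷ i ∷ []) → Adjacent i m
    adjacent-letters imi⊆t r = case dihedral i≢m of λ where
      (inj₂ adj) → adj
      (inj₁ com) → contradiction
        (≼-reflexive (commute com ⟦ [] ⟧))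
        (new-pair-∷ (here refl) (i≢m ∘ sym) imi⊆t r)

    -- The pair `i j` ought to be new when the first `i` is added, but the second `i` already
    -- provides it.
    no-letter-after : (j : Fin n) → i ∷ m ∷ i ∷ j ∷ [] ⊆ t → ¬ Reduced (i ∷ m ∷ i ∷ j ∷ [])
    no-letter-after j y⊆t r =
      new-pair-∷ (there (there (here refl)))
        (λ { refl → ¬Reduced-square (Reduced-tail (Reduced-tail r)) }) y⊆t r
        (⊆⇒≼ (Reduced-tail r) ≃-refl (m ∷ʳ refl ∷ refl ∷ []))

    -- The letter added is now the last one, so `new-pair-∷` does not apply; instead every
    -- two-letter subword of `j i m i` is checked against `j i m`.
    no-letter-before : (j : Fin n) → j ∷ i ∷ m ∷ i ∷ [] ⊆ t → ¬ Reduced (j ∷ i ∷ m ∷ i ∷ [])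
    no-letter-before j y⊆t r =
      case new-pair {x = j ∷ i ∷ m ∷ []} (here refl) (refl ∷ refl ∷ refl ∷ i ∷ʳ []) y⊆t rx r ≤-refl of λ where
        (_ , _ , refl ∷ refl ∷ _ , _ , _ , new)                → new (⊆⇒≼ rx ≃-refl (refl ∷ refl ∷ _ ∷ʳ []))
        (_ , _ , refl ∷ _ ∷ʳ refl ∷ _ , _ , _ , new)           → new (⊆⇒≼ rx ≃-refl (refl ∷ _ ∷ʳ refl ∷ []))
        (_ , _ , refl ∷ _ ∷ʳ _ ∷ʳ refl ∷ _ , _ , _ , new)      → new (⊆⇒≼ rx ≃-refl (refl ∷ refl ∷ _ ∷ʳ []))
        (_ , _ , _ ∷ʳ refl ∷ refl ∷ _ , _ , _ , new)           → new (⊆⇒≼ rx ≃-refl (_ ∷ʳ refl ∷ refl ∷ []))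
        (_ , _ , _ ∷ʳ refl ∷ _ ∷ʳ refl ∷ _ , rii , _ , _)      → ¬Reduced-square rii
        -- The pair `m i` contains `j` in two ways only. If `j` is `m`, it is the beginning of
        -- `j i m`; if `j` is `i`, the long word begins with a square.
        (_ , _ , _ ∷ʳ _ ∷ʳ refl ∷ refl ∷ _ , _ , here refl , new) →
          new (⊆⇒≼ rx ≃-refl (refl ∷ refl ∷ _ ∷ʳ []))
        (_ , _ , _ ∷ʳ _ ∷ʳ refl ∷ refl ∷ _ , _ , there (here refl) , _) → ¬Reduced-square r
        (_ , _ , refl ∷ _ ∷ʳ _ ∷ʳ _ ∷ʳ () , _)
        (_ , _ , _ ∷ʳ refl ∷ _ ∷ʳ _ ∷ʳ () , _)
        (_ , _ , _ ∷ʳ _ ∷ʳ refl ∷ _ ∷ʳ () , _)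
        (_ , _ , _ ∷ʳ _ ∷ʳ _ ∷ʳ refl ∷ () , _)
        (_ , _ , _ ∷ʳ _ ∷ʳ _ ∷ʳ _ ∷ʳ () , _)
      where
      rx : Reduced (j ∷ i ∷ m ∷ [])
      rx = Reduced-++ˡ (j ∷ i ∷ m ∷ []) r

repetition⇒braid : {w : 𝔖 n} {t : Word n} → Reduced t → ⟦ t ⟧ ≃ w →
  (∀ {i} → i ∈ˡ t → IsBoolean [ σ i , w ]) → Repetition t → IsBraid w
repetition⇒braid {n} {w} rt pt boolean (repetition a i p b i∉p p-unique) =
  go a b rt pt boolean (singleton i∉p p-unique (++⁺ˡ a (refl ∷ ++⁺ ⊆-refl (refl ∷ minimum b)))
    (Reduced-++ˡ (i ∷ p ++ i ∷ []) (subst Reduced (cong (i ∷_) (sym (++-assoc p (i ∷ []) b))) (Reduced-++ʳ a rt))))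
  where
  open BooleanAbove rt pt boolean using (singleton)

  braid-of : ∀ {m} → i ≢ m → Reduced (i ∷ m ∷ i ∷ []) → ⟦ i ∷ m ∷ i ∷ [] ⟧ ≃ w →
    (∀ {j} → j ∈ˡ i ∷ m ∷ i ∷ [] → IsBoolean [ σ j , w ]) → IsBraid w
  braid-of {m} i≢m r e bool = case consecutive adj of λ where
      -- The larger letter has to stand outside, so in this orientation the braid relation rewrites
      -- `i m i` as `m i m`.
      (inj₁ m≡1+i) → i , m , m≡1+i ,
        at {v = w} {σ m · σ i · σ m} (≃-trans (≃-sym e) (≃-trans (braid adj id) (pointwise λ _ → refl)))
      (inj₂ i≡1+m) → m , i , i≡1+m , at {v = w} {σ i · σ m · σ i} (≃-trans (≃-sym e) (pointwise λ _ → refl))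
    where
    adj : Adjacent i m
    adj = BooleanAbove.adjacent-letters r e bool i≢m ⊆-refl r

  go : ∀ a b → Reduced (a ++ i ∷ p ++ i ∷ b) → ⟦ a ++ i ∷ p ++ i ∷ b ⟧ ≃ w →
    (∀ {j} → j ∈ˡ a ++ i ∷ p ++ i ∷ b → IsBoolean [ σ j , w ]) → (∃ λ m → p ≡ m ∷ []) → IsBraid w
  go a (j ∷ b) rt pt boolean (m , refl) = contradiction
    (Reduced-++ˡ (i ∷ m ∷ i ∷ j ∷ []) (Reduced-++ʳ a rt))
    (BooleanAbove.no-letter-after rt pt boolean (i∉p ∘ here) j
      (++⁺ˡ a (refl ∷ refl ∷ refl ∷ refl ∷ minimum b)))
  go a [] rt pt boolean (m , refl) with initLast a
  ... | []       = braid-of (i∉p ∘ here) rt pt boolean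
  ... | a′ ∷ʳ′ j = contradiction (Reduced-++ʳ a′ (subst Reduced assoc rt))
    (BooleanAbove.no-letter-before rt pt boolean (i∉p ∘ here) j
      (subst (j ∷ i ∷ m ∷ i ∷ [] ⊆_) (sym assoc) (++⁺ˡ a′ ⊆-refl)))
    where
    assoc : (a′ ++ j ∷ []) ++ i ∷ m ∷ i ∷ [] ≡ a′ ++ j ∷ i ∷ m ∷ i ∷ []
    assoc = ++-assoc a′ (j ∷ []) (i ∷ m ∷ i ∷ [])

-- The equivalences

module _ {w : 𝔖 n} where

  intervals-boolean⇒ : (∀ i → support w i → IsBoolean [ σ i , w ]) →
    IsProductOfDistinctGenerators w ⊎ IsBraid w
  intervals-boolean⇒ boolean = case reducedWord w of λ where
    (t , rt , pt) → case unique-or-repetition t of λ where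
      (inj₁ uniq) → inj₁ (t , uniq , at pt)
      (inj₂ rep)  → inj₂ (repetition⇒braid rt pt
        (λ {i} i∈t → boolean i (t , (at pt , λ s e → minimal rt s (≃-trans (pointwise e) (≃-sym pt))) , i∈t)) rep)

  distinct⇒intervals-boolean : IsProductOfDistinctGenerators w →
    ∀ i → support w i → IsBoolean [ σ i , w ]
  distinct⇒intervals-boolean (t , uniq , e) i i∈ =
    boolean-↓⇒boolean (support⇒σ≼ {w = w} i∈) (distinct⇒boolean {w = w} uniq (pointwise e))

  braid⇒intervals-boolean : IsBraid w → ∀ i → support w i → IsBoolean [ σ i , w ]
  braid⇒intervals-boolean (k , l , l≡1+k , e) i i∈ = rank-two⇒boolean (support⇒σ≼ {w = w} i∈)
    (trans (Reduced⇒len (braid-Reduced (adjacent l≡1+k) k≢l) (pointwise λ x → sym (e x)))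
           (cong (2 +_) (sym (len-σ i))))
    where
    k≢l : k ≢ l
    k≢l refl = ℕ.1+n≢n (sym l≡1+k)

  boolean⇔modular : {v : 𝔖 n} → v ≼ w → IsBoolean [ v , w ] ⇔ FormsModularLattice [ v , w ]
  boolean⇔modular v≼w = mk⇔
    (λ B → distributive⇒modular _ (boolean⇒distributive _ B)) (modular⇒boolean v≼w)

  boolean⇔distributive : {v : 𝔖 n} → v ≼ w → IsBoolean [ v , w ] ⇔ FormsDistributiveLattice [ v , w ]
  boolean⇔distributive v≼w = mk⇔
    (boolean⇒distributive _) (λ D → modular⇒boolean v≼w (distributive⇒modular _ D))

  distinct⇔boolean-↓ : IsProductOfDistinctGenerators w ⇔ IsBoolean (↓ w)
  distinct⇔boolean-↓ = mk⇔
    (λ (t , uniq , e) → distinct⇒boolean {w = w} uniq (pointwise e))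
    (λ B → case reducedWord w of λ where
      (t , rt , pt) → t , boolean-↓⇒Unique B t rt (≼-reflexive pt) , at pt)

corollary6p3 : (n : ℕ) (w : 𝔖 n) →
    ((∀ i → i ∈ support w → IsBoolean [ σ i , w ])
    ⇔ (IsProductOfDistinctGenerators w ⊎ IsBraid w))
    × (∀ i → i ∈ support w →
    (IsBoolean [ σ i , w ] ⇔ FormsModularLattice [ σ i , w ])
    × (IsBoolean [ σ i , w ] ⇔ FormsDistributiveLattice [ σ i , w ]))
    × (IsProductOfDistinctGenerators w ⇔ IsBoolean (↓ w))
corollary6p3 n w =
    mk⇔ (intervals-boolean⇒ {w = w}) (λ where
      (inj₁ distinct) → distinct⇒intervals-boolean {w = w} distinct
      (inj₂ braid)    → braid⇒intervals-boolean {w = w} braid)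
  , (λ i i∈ → boolean⇔modular (support⇒σ≼ {w = w} i∈) , boolean⇔distributive (support⇒σ≼ {w = w} i∈))
  , distinct⇔boolean-↓ {w = w}
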